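{- Let $\Phi(a,b)$ be the $6\times 6$ array of vectors in $\mathbb{C}^6$, depending on real $a,b>0$ with $a^2+b^2=1$, defined in the context. Then the array $\Phi_{25}=\Phi\left(\frac45,\frac35\right)$ is a quantum Latin square of order $6$ and its cardinality is $25$.
   Context: A quantum Latin square of order $n$, denoted $\mathrm{QLS}(n)$, is an $n\times n$ array of unit vectors in $\mathbb{C}^n$ such that every row and every column forms an orthonormal basis of $\mathbb{C}^n$. Two unit vectors $u,v$ are phase equivalent if $u=e^{i\alpha}v$ for some $\alpha\in\mathbb{R}$. The cardinality of a quantum Latin square is the number of distinct phase-equivalence classes among its $n^2$ entries. Let $e_0,\dots,e_5$ be the standard basis of $\mathbb{C}^6=\mathcal U\oplus\mathcal V$, where $\mathcal U=\operatorname{span}\{e_0,e_1,e_2,e_3\}$ and $\mathcal V=\operatorname{span}\{e_4,e_5\}$. Let $\rho=1/\sqrt2$, and let $a,b>0$ be real with $a^2+b^2=1$. A $4$-tuple $(t_0,t_1,t_2,t_3)$ denotes the vector $t_0e_0+t_1e_1+t_2e_2+t_3e_3\in\mathcal U$. Define the following vectors of $\mathcal U$: $A=(1,0,0,0)$, $B=(0,1,0,0)$, $C=(0,0,1,0)$, $D=(0,0,0,1)$, $E=(0,a,b\rho,b\rho)$, $F=(a,0,b\rho,-b\rho)$, $G=(b\rho,-b\rho,0,a)$, $H=(-b\rho,-b\rho,a,0)$, $I=(0,-b,a\rho,a\rho)$, $J=(-b,0,a\rho,-a\rho)$, $K=(-a\rho,a\rho,0,b)$, $L=(a\rho,a\rho,b,0)$,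 $M=(-a\rho,a\rho,b,0)$, $N=(b\rho,-b\rho,a,0)$, $O=(\rho,\rho,0,0)$, $P=(a\rho,a\rho,0,b)$, $Q=(-b\rho,-b\rho,0,a)$, $R=(-\rho,\rho,0,0)$, $S=(0,0,\rho,\rho)$, $T=(b,0,a\rho,-a\rho)$, $U=(-a,0,b\rho,-b\rho)$. Define in $\mathcal V$: $x=e_4$, $y=e_5$, $z=\rho(e_4+e_5)$, $w=\rho(e_4-e_5)$. Set $$\Phi(a,b)=\begin{pmatrix} x & A & y & B & C & D \\ y & x & E & F & G & H \\ I & y & x & J & K & L \\ M & D & N & z & O & w \\ P & C & Q & w & z & R \\ T & B & U & S & w & z \end{pmatrix}.$$ -}

module Defs where

open import Algebra.Bundles using (CommutativeRing; Semiring)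
open import Algebra.Consequences.Setoid using (comm∧idˡ⇒id; comm∧distrˡ⇒distr)
import Algebra.Definitions.RawSemiring as RawSemiringDefs
import Algebra.Solver.Ring as RingSolver
open import Algebra.Solver.Ring.AlmostCommutativeRing
  using (AlmostCommutativeRing; fromCommutativeRing; _-Raw-AlmostCommutative⟶_)
open import Data.Fin.Base using (Fin; toℕ)
import Data.Integer.Base as ℤ
import Data.Maybe.Base as Maybe
open import Data.Nat.Base as ℕ using (ℕ; zero; suc; _!)
open import Data.Nat.Properties as ℕ using (_!≢0)
open import Data.Product.Base using (∃-syntax; _×_; _,_; proj₁; proj₂; uncurry)
open import Data.Rational.Base as ℚ using (ℚ; 0ℚ; 1ℚ; ½; mkℚ)
import Data.Rational.Properties as ℚ
open import Data.Rational.Solver using (module +-*-Solver)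
import Data.Rational.Unnormalised.Base as ℚᵘ
import Data.Rational.Unnormalised.Properties as ℚᵘ
open import Data.Sum.Base using (inj₁; inj₂)
open import Data.Vec.Base using ([]; _∷_; lookup)
open import Data.Vec.Functional using (Vector)
open import Function.Definitions using (Bijective; Congruent)
open import Level using (0ℓ)
open import Relation.Binary.Bundles using (Setoid)
open import Relation.Binary.PropositionalEquality
  using (_≡_; _≢_; refl; sym; trans; cong; subst; subst₂)
open import Relation.Binary.Structures using (IsEquivalence)
open import Relation.Nullary using (yes; no)
open import Relation.Nullary.Decidable using (dec⇒maybe)

private
  infix 4 _<ᵠ_
  _<ᵠ_ : ℚ → ℚ → Set
  _<ᵠ_ = ℚ._<_

  0<½ : 0ℚ <ᵠ ½
  0<½ = ℚ.positive⁻¹ ½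

  0<1 : 0ℚ <ᵠ 1ℚ
  0<1 = ℚ.positive⁻¹ 1ℚ

  0<* : ∀ {p q} → 0ℚ <ᵠ p → 0ℚ <ᵠ q → 0ℚ <ᵠ p ℚ.* q
  0<* {p} {q} p>0 q>0 = ℚ.positive⁻¹ (p ℚ.* q)
    where instance
      _ = ℚ.positive p>0
      _ = ℚ.positive q>0
      _ = ℚ.pos*pos⇒pos p q

  <+ʳ : ∀ p {q} → 0ℚ <ᵠ q → p <ᵠ p ℚ.+ q
  <+ʳ p {q} q>0 = subst (_<ᵠ p ℚ.+ q) (ℚ.+-identityʳ p) (ℚ.+-monoʳ-< p q>0)

  <+ˡ : ∀ {p} q → 0ℚ <ᵠ p → q <ᵠ p ℚ.+ q
  <+ˡ {p} q p>0 = subst (_<ᵠ p ℚ.+ q) (ℚ.+-identityˡ q) (ℚ.+-monoˡ-< q p>0)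

  opaque
    larger : ∀ K L → 0ℚ <ᵠ K → 0ℚ <ᵠ L → ∃[ M ] (K <ᵠ M × L <ᵠ M)
    larger K L K>0 L>0 = K ℚ.+ L , <+ʳ K L>0 , <+ˡ L K>0

  halve : ∀ ε → ½ ℚ.* ε ℚ.+ ½ ℚ.* ε ≡ ε
  halve = solve 1 (λ e → con ½ :* e :+ con ½ :* e := e) refl
    where open +-*-Solver

  ∣p-q∣≡∣q-p∣ : ∀ p q → ℚ.∣ p ℚ.- q ∣ ≡ ℚ.∣ q ℚ.- p ∣
  ∣p-q∣≡∣q-p∣ p q = trans
    (cong ℚ.∣_∣ (solve 2 (λ p q → p :- q := :- (q :- p)) refl p q))
    (ℚ.∣-p∣≡∣p∣ (q ℚ.- p))
    where open +-*-Solver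

  ∣+∣< : ∀ {ε} p q → ℚ.∣ p ∣ <ᵠ ½ ℚ.* ε → ℚ.∣ q ∣ <ᵠ ½ ℚ.* ε → ℚ.∣ p ℚ.+ q ∣ <ᵠ ε
  ∣+∣< {ε} p q p< q< = ℚ.≤-<-trans (ℚ.∣p+q∣≤∣p∣+∣q∣ p q)
    (subst (ℚ.∣ p ∣ ℚ.+ ℚ.∣ q ∣ <ᵠ_) (halve ε) (ℚ.+-mono-< p< q<))

  ∣*∣≤ : ∀ {K δ} p q → ℚ.∣ p ∣ <ᵠ K → ℚ.∣ q ∣ <ᵠ δ → 0ℚ <ᵠ K → ℚ.∣ p ℚ.* q ∣ <ᵠ K ℚ.* δ
  ∣*∣≤ {K} {δ} p q p< q< K>0 = subst (_<ᵠ K ℚ.* δ) (sym (ℚ.∣p*q∣≡∣p∣*∣q∣ p q))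
    (ℚ.≤-<-trans
      (ℚ.*-monoʳ-≤-nonNeg ℚ.∣ q ∣ {{ℚ.∣-∣-nonNeg q}} (ℚ.<⇒≤ p<))
      (ℚ.*-monoʳ-<-pos K {{ℚ.positive K>0}} q<))

  opaque
    shrink : ∀ K ε → 0ℚ <ᵠ K → 0ℚ <ᵠ ε → ∃[ δ ] (0ℚ <ᵠ δ × K ℚ.* δ ≡ ε)
    shrink K ε K>0 ε>0 = 1/K ℚ.* ε ,
      0<* (ℚ.positive⁻¹ 1/K {{ℚ.1/pos⇒pos K {{ℚ.positive K>0}}}}) ε>0 ,
      trans (sym (ℚ.*-assoc K 1/K ε))
        (trans (cong (ℚ._* ε) (ℚ.*-inverseʳ K {{K≢0}})) (ℚ.*-identityˡ ε))
      where
      K≢0 : ℚ.NonZero K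
      K≢0 = ℚ.pos⇒nonZero K {{ℚ.positive K>0}}
      1/K : ℚ
      1/K = (ℚ.1/ K) {{K≢0}}

  ∣-∣< : ∀ {ε p q} → p <ᵠ q ℚ.+ ε → q <ᵠ p ℚ.+ ε → ℚ.∣ p ℚ.- q ∣ <ᵠ ε
  ∣-∣< {ε} {p} {q} p< q< with ℚ.∣p∣≡p∨∣p∣≡-p (p ℚ.- q)
  ... | inj₁ eq = subst₂ _<ᵠ_ (sym eq)
    (solve 2 (λ q e → (q :+ e) :- q := e) refl q ε) (ℚ.+-monoˡ-< (ℚ.- q) p<)
    where open +-*-Solver
  ... | inj₂ eq = subst₂ _<ᵠ_
    (trans (solve 2 (λ p q → q :- p := :- (p :- q)) refl p q) (sym eq))
    (solve 2 (λ p e → (p :+ e) :- p := e) refl p ε) (ℚ.+-monoˡ-< (ℚ.- p) q<)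
    where open +-*-Solver

Eventually : (ℕ → Set) → Set
Eventually P = ∃[ N ] (∀ n → N ℕ.≤ n → P n)

private
  ⊔≤⇒≤ˡ : ∀ m n {o} → m ℕ.⊔ n ℕ.≤ o → m ℕ.≤ o
  ⊔≤⇒≤ˡ m n = ℕ.≤-trans (ℕ.m≤m⊔n m n)

  ⊔≤⇒≤ʳ : ∀ m n {o} → m ℕ.⊔ n ℕ.≤ o → n ℕ.≤ o
  ⊔≤⇒≤ʳ m n = ℕ.≤-trans (ℕ.m≤n⊔m m n)

  both : ∀ {P Q R : ℕ → Set} → (∀ n → P n → Q n → R n) →
         Eventually P → Eventually Q → Eventually R
  both f (M , p) (N , q) = M ℕ.⊔ N , λ n h →
    f n (p n (⊔≤⇒≤ˡ M N h)) (q n (⊔≤⇒≤ʳ M N h))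

  each : ∀ {P Q : ℕ → Set} → (∀ n → P n → Q n) → Eventually P → Eventually Q
  each f (N , p) = N , λ n h → f n (p n h)

record ℝ : Set where
  no-eta-equality
  field
    seq    : ℕ → ℚ
    cauchy : ∀ ε → 0ℚ ℚ.< ε →
             ∃[ N ] (∀ m n → N ℕ.≤ m → N ℕ.≤ n → ℚ.∣ seq m ℚ.- seq n ∣ ℚ.< ε)

open ℝ public

infix  4 _≈_ _<_
infixl 6 _+_
infixl 7 _*_
infix  8 -_

-- A record rather than a function, so that both sides can be inferred from a proof.
record _≈_ (r s : ℝ) : Set where
  constructor mk≈
  field
    close : ∀ ε → 0ℚ ℚ.< ε → Eventually λ n → ℚ.∣ seq r n ℚ.- seq s n ∣ ℚ.< ε

open _≈_ public

_<_ : ℝ → ℝ → Set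
r < s = ∃[ ε ] (0ℚ ℚ.< ε × Eventually λ n → seq r n ℚ.+ ε ℚ.< seq s n)

fromℚ : ℚ → ℝ
seq    (fromℚ q) _ = q
cauchy (fromℚ q) ε ε>0 = 0 , λ _ _ _ _ →
  subst (ℚ._< ε) (cong ℚ.∣_∣ (sym (ℚ.+-inverseʳ q))) ε>0

0ℝ 1ℝ : ℝ
0ℝ = fromℚ 0ℚ
1ℝ = fromℚ 1ℚ

private
  +-split : ∀ p q p′ q′ → (p ℚ.- p′) ℚ.+ (q ℚ.- q′) ≡ (p ℚ.+ q) ℚ.- (p′ ℚ.+ q′)
  +-split = solve 4 (λ p q p′ q′ → (p :- p′) :+ (q :- q′) := (p :+ q) :- (p′ :+ q′)) refl
    where open +-*-Solver

  *-split : ∀ p q p′ q′ → p ℚ.* (q ℚ.- q′) ℚ.+ q′ ℚ.* (p ℚ.- p′) ≡ p ℚ.* q ℚ.- p′ ℚ.* q′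
  *-split = solve 4 (λ p q p′ q′ → p :* (q :- q′) :+ q′ :* (p :- p′) := p :* q :- p′ :* q′) refl
    where open +-*-Solver

  neg-split : ∀ p q → ℚ.∣ p ℚ.- q ∣ ≡ ℚ.∣ ℚ.- p ℚ.- ℚ.- q ∣
  neg-split p q = trans (sym (ℚ.∣-p∣≡∣p∣ (p ℚ.- q)))
    (cong ℚ.∣_∣ (solve 2 (λ p q → :- (p :- q) := (:- p) :- (:- q)) refl p q))
    where open +-*-Solver

  +-close : ∀ {ε} p q p′ q′ → ℚ.∣ p ℚ.- p′ ∣ <ᵠ ½ ℚ.* ε → ℚ.∣ q ℚ.- q′ ∣ <ᵠ ½ ℚ.* ε →
            ℚ.∣ (p ℚ.+ q) ℚ.- (p′ ℚ.+ q′) ∣ <ᵠ ε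
  +-close {ε} p q p′ q′ h k = subst (λ t → ℚ.∣ t ∣ <ᵠ ε) (+-split p q p′ q′)
    (∣+∣< (p ℚ.- p′) (q ℚ.- q′) h k)

  *-close : ∀ {ε K δ} p q p′ q′ → 0ℚ <ᵠ K → K ℚ.* δ ≡ ½ ℚ.* ε →
            ℚ.∣ p ∣ <ᵠ K → ℚ.∣ q′ ∣ <ᵠ K →
            ℚ.∣ p ℚ.- p′ ∣ <ᵠ δ → ℚ.∣ q ℚ.- q′ ∣ <ᵠ δ →
            ℚ.∣ p ℚ.* q ℚ.- p′ ℚ.* q′ ∣ <ᵠ ε
  *-close {ε} {K} {δ} p q p′ q′ K>0 eq p< q< h k =
    subst (λ t → ℚ.∣ t ∣ <ᵠ ε) (*-split p q p′ q′)
      (∣+∣< (p ℚ.* (q ℚ.- q′)) (q′ ℚ.* (p ℚ.- p′))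
        (subst (ℚ.∣ p ℚ.* (q ℚ.- q′) ∣ <ᵠ_) eq (∣*∣≤ p (q ℚ.- q′) p< k K>0))
        (subst (ℚ.∣ q′ ℚ.* (p ℚ.- p′) ∣ <ᵠ_) eq (∣*∣≤ q′ (p ℚ.- p′) q< h K>0)))

  opaque
    bounded : ∀ x → ∃[ K ] (0ℚ <ᵠ K × Eventually λ n → ℚ.∣ seq x n ∣ <ᵠ K)
    bounded x =
      let N , near = cauchy x 1ℚ 0<1
          B = ℚ.∣ seq x N ∣
      in 1ℚ ℚ.+ B , ℚ.<-≤-trans 0<1 (1≤1+B (seq x N)) , N , λ n h →
        ℚ.≤-<-trans
          (subst (λ t → ℚ.∣ t ∣ ℚ.≤ ℚ.∣ seq x n ℚ.- seq x N ∣ ℚ.+ B)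
            (solve 2 (λ p q → (p :- q) :+ q := p) refl (seq x n) (seq x N))
            (ℚ.∣p+q∣≤∣p∣+∣q∣ (seq x n ℚ.- seq x N) (seq x N)))
          (ℚ.+-monoˡ-< B (near n N h ℕ.≤-refl))
      where
      open +-*-Solver
      1≤1+B : ∀ p → 1ℚ ℚ.≤ 1ℚ ℚ.+ ℚ.∣ p ∣
      1≤1+B p = ℚ.+-monoʳ-≤ 1ℚ (ℚ.0≤∣p∣ p)

  opaque
    bounded₂ : ∀ x y → ∃[ K ] (0ℚ <ᵠ K ×
               Eventually λ n → ℚ.∣ seq x n ∣ <ᵠ K × ℚ.∣ seq y n ∣ <ᵠ K)
    bounded₂ x y =
      let K , K>0 , x< = bounded x
          L , L>0 , y< = bounded y
          M , K<M , L<M = larger K L K>0 L>0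
      in M , ℚ.<-trans K>0 K<M , both (λ n p q → ℚ.<-trans p K<M , ℚ.<-trans q L<M) x< y<

_+_ : ℝ → ℝ → ℝ
seq    (x + y) n = seq x n ℚ.+ seq y n
cauchy (x + y) ε ε>0 =
  let M , p = cauchy x (½ ℚ.* ε) (0<* 0<½ ε>0)
      N , q = cauchy y (½ ℚ.* ε) (0<* 0<½ ε>0)
  in M ℕ.⊔ N , λ m n h k →
    +-close (seq x m) (seq y m) (seq x n) (seq y n)
      (p m n (⊔≤⇒≤ˡ M N h) (⊔≤⇒≤ˡ M N k))
      (q m n (⊔≤⇒≤ʳ M N h) (⊔≤⇒≤ʳ M N k))

_*_ : ℝ → ℝ → ℝ
seq    (x * y) n = seq x n ℚ.* seq y n
cauchy (x * y) ε ε>0 =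
  let K , K>0 , L , bd = bounded₂ x y
      δ , δ>0 , eq = shrink K (½ ℚ.* ε) K>0 (0<* 0<½ ε>0)
      M , p = cauchy x δ δ>0
      N , q = cauchy y δ δ>0
  in L ℕ.⊔ (M ℕ.⊔ N) , λ m n h k →
    let h′ = ⊔≤⇒≤ʳ L (M ℕ.⊔ N) h
        k′ = ⊔≤⇒≤ʳ L (M ℕ.⊔ N) k
    in *-close (seq x m) (seq y m) (seq x n) (seq y n) K>0 eq
      (proj₁ (bd m (⊔≤⇒≤ˡ L (M ℕ.⊔ N) h))) (proj₂ (bd n (⊔≤⇒≤ˡ L (M ℕ.⊔ N) k)))
      (p m n (⊔≤⇒≤ˡ M N h′) (⊔≤⇒≤ˡ M N k′)) (q m n (⊔≤⇒≤ʳ M N h′) (⊔≤⇒≤ʳ M N k′))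

-_ : ℝ → ℝ
seq    (- x) n = ℚ.- seq x n
cauchy (- x) ε ε>0 =
  let N , p = cauchy x ε ε>0
  in N , λ m n h k → subst (ℚ._< ε) (neg-split (seq x m) (seq x n)) (p m n h k)

private
  pointwise : ∀ {x y} → (∀ n → seq x n ≡ seq y n) → x ≈ y
  close (pointwise {x} {y} eq) ε ε>0 = 0 , λ n _ → subst (_<ᵠ ε)
    (cong ℚ.∣_∣ (sym (trans (cong (ℚ._- seq y n) (eq n)) (ℚ.+-inverseʳ (seq y n))))) ε>0

  ≈-sym : ∀ {x y} → x ≈ y → y ≈ x
  close (≈-sym {x} {y} x≈y) ε ε>0 =
    each (λ n → subst (_<ᵠ ε) (∣p-q∣≡∣q-p∣ (seq x n) (seq y n))) (close x≈y ε ε>0)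

  ≈-trans : ∀ {x y z} → x ≈ y → y ≈ z → x ≈ z
  close (≈-trans {x} {y} {z} x≈y y≈z) ε ε>0 = both
    (λ n h k → subst (λ t → ℚ.∣ t ∣ <ᵠ ε)
      (solve 3 (λ p q r → (p :- q) :+ (q :- r) := p :- r) refl (seq x n) (seq y n) (seq z n))
      (∣+∣< (seq x n ℚ.- seq y n) (seq y n ℚ.- seq z n) h k))
    (close x≈y _ (0<* 0<½ ε>0)) (close y≈z _ (0<* 0<½ ε>0))
    where open +-*-Solver

  +-cong : ∀ {x x′ y y′} → x ≈ x′ → y ≈ y′ → x + y ≈ x′ + y′
  close (+-cong {x} {x′} {y} {y′} p q) ε ε>0 = both
    (λ n → +-close (seq x n) (seq y n) (seq x′ n) (seq y′ n))
    (close p _ (0<* 0<½ ε>0)) (close q _ (0<* 0<½ ε>0))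

  *-cong : ∀ {x x′ y y′} → x ≈ x′ → y ≈ y′ → x * y ≈ x′ * y′
  close (*-cong {x} {x′} {y} {y′} p q) ε ε>0 =
    let K , K>0 , bd = bounded₂ x y′
        δ , δ>0 , eq = shrink K (½ ℚ.* ε) K>0 (0<* 0<½ ε>0)
    in both
      (λ n (b , b′) (h , k) → *-close (seq x n) (seq y n) (seq x′ n) (seq y′ n) K>0 eq b b′ h k)
      bd (both (λ n → _,_) (close p δ δ>0) (close q δ δ>0))

  -‿cong : ∀ {x y} → x ≈ y → - x ≈ - y
  close (-‿cong {x} {y} p) ε ε>0 =
    each (λ n → subst (_<ᵠ ε) (neg-split (seq x n) (seq y n))) (close p ε ε>0)

  ≈-isEquivalence : IsEquivalence _≈_
  ≈-isEquivalence = record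
    { refl = pointwise (λ _ → refl) ; sym = ≈-sym ; trans = ≈-trans }

ℝ-commutativeRing : CommutativeRing 0ℓ 0ℓ
ℝ-commutativeRing = record
  { Carrier = ℝ ; _≈_ = _≈_ ; _+_ = _+_ ; _*_ = _*_ ; -_ = -_ ; 0# = 0ℝ ; 1# = 1ℝ
  ; isCommutativeRing = record
    { isRing = record
      { +-isAbelianGroup = record
        { isGroup = record
          { isMonoid = record
            { isSemigroup = record
              { isMagma = record { isEquivalence = ≈-isEquivalence ; ∙-cong = +-cong }
              ; assoc = λ x y z → pointwise λ n → ℚ.+-assoc (seq x n) (seq y n) (seq z n)
              }
            ; identity = (λ x → pointwise λ n → ℚ.+-identityˡ (seq x n))
                       , (λ x → pointwise λ n → ℚ.+-identityʳ (seq x n))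
            }
          ; inverse = (λ x → pointwise λ n → ℚ.+-inverseˡ (seq x n))
                    , (λ x → pointwise λ n → ℚ.+-inverseʳ (seq x n))
          ; ⁻¹-cong = -‿cong
          }
        ; comm = λ x y → pointwise λ n → ℚ.+-comm (seq x n) (seq y n)
        }
      ; *-cong = *-cong
      ; *-assoc = λ x y z → pointwise λ n → ℚ.*-assoc (seq x n) (seq y n) (seq z n)
      ; *-identity = (λ x → pointwise λ n → ℚ.*-identityˡ (seq x n))
                   , (λ x → pointwise λ n → ℚ.*-identityʳ (seq x n))
      ; distrib =
          (λ x y z → pointwise λ n → ℚ.*-distribˡ-+ (seq x n) (seq y n) (seq z n))
        , (λ x y z → pointwise λ n → ℚ.*-distribʳ-+ (seq x n) (seq y n) (seq z n))
      }
    ; *-comm = λ x y → pointwise λ n → ℚ.*-comm (seq x n) (seq y n)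
    }
  }

fromℚ-+ : ∀ p q → fromℚ (p ℚ.+ q) ≈ fromℚ p + fromℚ q
fromℚ-+ p q = pointwise λ _ → refl

fromℚ-* : ∀ p q → fromℚ (p ℚ.* q) ≈ fromℚ p * fromℚ q
fromℚ-* p q = pointwise λ _ → refl

fromℚ-neg : ∀ p → fromℚ (ℚ.- p) ≈ - fromℚ p
fromℚ-neg p = pointwise λ _ → refl

private
  width : ℕ → ℚ
  width zero    = 1ℚ
  width (suc n) = ½ ℚ.* width n

  -- Bisection: ρ-seq n is the largest multiple of 2⁻ⁿ whose square is at most ½.
  ρ-seq : ℕ → ℚ
  ρ-seq zero = 0ℚ
  ρ-seq (suc n) with (ρ-seq n ℚ.+ width (suc n)) ℚ.* (ρ-seq n ℚ.+ width (suc n)) ℚ.≤? ½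
  ... | yes _ = ρ-seq n ℚ.+ width (suc n)
  ... | no  _ = ρ-seq n

  width>0 : ∀ n → 0ℚ <ᵠ width n
  width>0 zero    = 0<1
  width>0 (suc n) = 0<* 0<½ (width>0 n)

  ≤+ : ∀ p {q} → 0ℚ <ᵠ q → p ℚ.≤ p ℚ.+ q
  ≤+ p q>0 = ℚ.<⇒≤ (<+ʳ p q>0)

  ρ-seq-suc≥ : ∀ n → ρ-seq n ℚ.≤ ρ-seq (suc n)
  ρ-seq-suc≥ n with (ρ-seq n ℚ.+ width (suc n)) ℚ.* (ρ-seq n ℚ.+ width (suc n)) ℚ.≤? ½
  ... | yes _ = ≤+ (ρ-seq n) (width>0 (suc n))
  ... | no  _ = ℚ.≤-refl

  ρ-seq≥0 : ∀ n → 0ℚ ℚ.≤ ρ-seq n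
  ρ-seq≥0 zero    = ℚ.≤-refl
  ρ-seq≥0 (suc n) = ℚ.≤-trans (ρ-seq≥0 n) (ρ-seq-suc≥ n)

  ρ-seq≥½ : ∀ n → ½ ℚ.≤ ρ-seq (suc n)
  ρ-seq≥½ zero    = ℚ.≤-refl
  ρ-seq≥½ (suc n) = ℚ.≤-trans (ρ-seq≥½ n) (ρ-seq-suc≥ (suc n))

  lower : ∀ n → ρ-seq n ℚ.* ρ-seq n ℚ.≤ ½
  lower zero = ℚ.<⇒≤ 0<½
  lower (suc n) with (ρ-seq n ℚ.+ width (suc n)) ℚ.* (ρ-seq n ℚ.+ width (suc n)) ℚ.≤? ½
  ... | yes p = p
  ... | no  _ = lower n

  upper : ∀ n → ½ <ᵠ (ρ-seq n ℚ.+ width n) ℚ.* (ρ-seq n ℚ.+ width n)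
  upper zero = ℚ.*<* (ℤ.+<+ (ℕ.s≤s (ℕ.s≤s ℕ.z≤n)))
  upper (suc n) with (ρ-seq n ℚ.+ width (suc n)) ℚ.* (ρ-seq n ℚ.+ width (suc n)) ℚ.≤? ½
  ... | yes _ = subst (λ t → ½ <ᵠ t ℚ.* t)
    (solve 2 (λ p w → p :+ w := (p :+ con ½ :* w) :+ con ½ :* w) refl (ρ-seq n) (width n))
    (upper n)
    where open +-*-Solver
  ... | no p≰½ = ℚ.≰⇒> p≰½

  square-mono : ∀ {p q} → 0ℚ ℚ.≤ p → p ℚ.≤ q → p ℚ.* p ℚ.≤ q ℚ.* q
  square-mono {p} {q} 0≤p p≤q = ℚ.≤-trans
    (ℚ.*-monoʳ-≤-nonNeg p {{ℚ.nonNegative 0≤p}} p≤q)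
    (ℚ.*-monoˡ-≤-nonNeg q {{ℚ.nonNegative (ℚ.≤-trans 0≤p p≤q)}} p≤q)

  ρ-seq< : ∀ m n → ρ-seq m <ᵠ ρ-seq n ℚ.+ width n
  ρ-seq< m n = ℚ.≰⇒> λ le → ℚ.<-irrefl refl (ℚ.<-≤-trans (upper n)
    (ℚ.≤-trans (square-mono (ℚ.≤-trans (ρ-seq≥0 n) (≤+ (ρ-seq n) (width>0 n))) le) (lower m)))

  width-suc≤ : ∀ n → width (suc n) ℚ.≤ width n
  width-suc≤ n = subst (width (suc n) ℚ.≤_) (halve (width n))
    (≤+ (½ ℚ.* width n) (0<* 0<½ (width>0 n)))

  width-anti : ∀ {m n} → m ℕ.≤′ n → width n ℚ.≤ width m
  width-anti ℕ.≤′-refl               = ℚ.≤-refl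
  width-anti {n = suc n} (ℕ.≤′-step h) = ℚ.≤-trans (width-suc≤ n) (width-anti h)

  width≤1/suc : ∀ n → ℚ.toℚᵘ (width n) ℚᵘ.≤ ℚᵘ.mkℚᵘ (ℤ.+ 1) n
  width≤1/suc zero    = ℚᵘ.≤-refl
  width≤1/suc (suc n) = ℚᵘ.≤-trans
    (ℚᵘ.≤-reflexive (ℚ.toℚᵘ-homo-* ½ (width n)))
    (ℚᵘ.≤-trans (ℚᵘ.*-monoʳ-≤-nonNeg ℚᵘ.½ (width≤1/suc n))
      (ℚᵘ.*≤* (ℤ.+≤+ (ℕ.+-monoˡ-≤ 0 (s n)))))
    where
    s : ∀ n → suc (suc n) ℕ.≤ suc n ℕ.+ (suc n ℕ.+ 0)
    s n = ℕ.s≤s (ℕ.≤-trans (ℕ.m≤n+m (suc n) n)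
      (ℕ.≤-reflexive (cong (n ℕ.+_) (sym (ℕ.+-identityʳ (suc n))))))

  width-small : ∀ ε → 0ℚ <ᵠ ε → Eventually λ n → width n <ᵠ ε
  width-small ε@(mkℚ (ℤ.+ zero) _ _) ε>0 with () ← ℚ.positive ε>0
  width-small ε@(mkℚ ℤ.-[1+ _ ] _ _) ε>0 with () ← ℚ.positive ε>0
  width-small ε@(mkℚ ℤ.+[1+ p ] d _) _ = suc d , λ n h →
    ℚ.≤-<-trans (width-anti (ℕ.≤⇒≤′ h)) (ℚ.toℚᵘ-cancel-<
      (ℚᵘ.≤-<-trans (width≤1/suc (suc d))
        (ℚᵘ.*<* (ℤ.+<+ (ℕ.<-≤-trans
          (ℕ.s≤s (ℕ.s≤s (ℕ.≤-reflexive (ℕ.+-identityʳ d))))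
          (ℕ.m≤m+n (suc (suc d)) (p ℕ.* suc (suc d))))))))

-- 1/√2, characterised by 0<ρ and ρ*ρ≈½ below.
ρ : ℝ
seq    ρ = ρ-seq
cauchy ρ ε ε>0 =
  let N , w = width-small ε ε>0
  in N , λ m n h k → ∣-∣<
    (ℚ.<-trans (ρ-seq< m n) (ℚ.+-monoʳ-< (ρ-seq n) (w n k)))
    (ℚ.<-trans (ρ-seq< n m) (ℚ.+-monoʳ-< (ρ-seq m) (w m h)))

0<ρ : 0ℝ < ρ
0<ρ = ½ ℚ.* ½ , 0<* 0<½ 0<½ , 1 , λ { (suc n) _ →
  ℚ.<-≤-trans (ℚ.*<* (ℤ.+<+ (ℕ.s≤s (ℕ.s≤s (ℕ.s≤s ℕ.z≤n))))) (ρ-seq≥½ n) }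

ρ*ρ≈½ : ρ * ρ ≈ fromℚ ½
close ρ*ρ≈½ ε ε>0 with shrink (1ℚ ℚ.+ (1ℚ ℚ.+ 1ℚ)) ε (ℚ.positive⁻¹ _) ε>0
... | δ , δ>0 , eq = each (λ n w<δ → ∣-∣< {ε} (ℚ.≤-<-trans (lower n)
        (subst (_<ᵠ ½ ℚ.+ ε) (ℚ.+-identityʳ ½) (ℚ.+-monoʳ-< ½ ε>0)))
      (ℚ.<-trans (upper n) (subst₂ _<ᵠ_
        (solve 2 (λ p w → p :* p :+ w :* ((p :+ p) :+ w) := (p :+ w) :* (p :+ w)) refl (ρ-seq n) (width n))
        refl (ℚ.+-monoʳ-< (ρ-seq n ℚ.* ρ-seq n) (bound n w<δ)))))
    (width-small δ δ>0)
  where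
  open +-*-Solver
  bound : ∀ n → width n <ᵠ δ → width n ℚ.* ((ρ-seq n ℚ.+ ρ-seq n) ℚ.+ width n) <ᵠ ε
  bound n w<δ = ℚ.≤-<-trans
    (ℚ.*-monoˡ-≤-nonNeg (width n) {{ℚ.nonNegative (ℚ.<⇒≤ (width>0 n))}} {y = 1ℚ ℚ.+ 1ℚ ℚ.+ 1ℚ}
      (ℚ.+-mono-≤ (ℚ.+-mono-≤ (ℚ.<⇒≤ (ρ-seq< n 0)) (ℚ.<⇒≤ (ρ-seq< n 0))) (width-anti (ℕ.≤⇒≤′ (ℕ.z≤n {n})))))
    (subst (width n ℚ.* (1ℚ ℚ.+ 1ℚ ℚ.+ 1ℚ) <ᵠ_)
      (trans (ℚ.*-comm δ _) eq)
      (ℚ.*-monoˡ-<-pos (1ℚ ℚ.+ 1ℚ ℚ.+ 1ℚ) w<δ))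

private
  module ℝ-ring = CommutativeRing ℝ-commutativeRing

ℝ-almostCommutativeRing : AlmostCommutativeRing 0ℓ 0ℓ
ℝ-almostCommutativeRing = fromCommutativeRing ℝ-commutativeRing

fromℚ-homomorphism : ℚ.+-*-rawRing -Raw-AlmostCommutative⟶ ℝ-almostCommutativeRing
fromℚ-homomorphism = record
  { ⟦_⟧    = fromℚ
  ; +-homo = fromℚ-+
  ; *-homo = fromℚ-*
  ; -‿homo = fromℚ-neg
  ; 0-homo = ℝ-ring.refl
  ; 1-homo = ℝ-ring.refl
  }

module ℝ-Solver = RingSolver ℚ.+-*-rawRing ℝ-almostCommutativeRing fromℚ-homomorphism
  (λ p q → Maybe.map (λ p≡q → ℝ-ring.reflexive (cong fromℚ p≡q)) (dec⇒maybe (p ℚ.≟ q)))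

infix  4 _≈ᶜ_
infixl 6 _+ᶜ_
infixl 7 _*ᶜ_
infix  8 -ᶜ_

record ℂ : Set where
  no-eta-equality
  field
    re im : ℝ

open ℂ public

record _≈ᶜ_ (z w : ℂ) : Set where
  constructor mk≈ᶜ
  field
    re≈ : re z ≈ re w
    im≈ : im z ≈ im w

open _≈ᶜ_ public

_+ᶜ_ _*ᶜ_ : ℂ → ℂ → ℂ
re (z +ᶜ w) = re z + re w
im (z +ᶜ w) = im z + im w
re (z *ᶜ w) = re z * re w + - (im z * im w)
im (z *ᶜ w) = re z * im w + im z * re w

-ᶜ_ conj : ℂ → ℂ
re (-ᶜ z)   = - re z
im (-ᶜ z)   = - im z
re (conj z) = re z
im (conj z) = - im z

fromℝ : ℝ → ℂ
re (fromℝ r) = r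
im (fromℝ r) = 0ℝ

0ᶜ 1ᶜ 𝕚 : ℂ
0ᶜ = fromℝ 0ℝ
1ᶜ = fromℝ 1ℝ
re 𝕚 = 0ℝ
im 𝕚 = 1ℝ

∣_∣² : ℂ → ℝ
∣ z ∣² = re z * re z + im z * im z

private
  *ᶜ-assoc : ∀ z w v → (z *ᶜ w) *ᶜ v ≈ᶜ z *ᶜ (w *ᶜ v)
  *ᶜ-assoc z w v = mk≈ᶜ
    (solve 6 (λ a b c d e f →
      (a :* c :- b :* d) :* e :- (a :* d :+ b :* c) :* f :=
      a :* (c :* e :- d :* f) :- b :* (c :* f :+ d :* e)) ℝ-ring.refl
      (re z) (im z) (re w) (im w) (re v) (im v))
    (solve 6 (λ a b c d e f →
      (a :* c :- b :* d) :* f :+ (a :* d :+ b :* c) :* e :=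
      a :* (c :* f :+ d :* e) :+ b :* (c :* e :- d :* f)) ℝ-ring.refl
      (re z) (im z) (re w) (im w) (re v) (im v))
    where open ℝ-Solver

  *ᶜ-comm : ∀ z w → z *ᶜ w ≈ᶜ w *ᶜ z
  *ᶜ-comm z w = mk≈ᶜ
    (solve 4 (λ a b c d → a :* c :- b :* d := c :* a :- d :* b) ℝ-ring.refl
      (re z) (im z) (re w) (im w))
    (solve 4 (λ a b c d → a :* d :+ b :* c := c :* b :+ d :* a) ℝ-ring.refl
      (re z) (im z) (re w) (im w))
    where open ℝ-Solver

  *ᶜ-identityˡ : ∀ z → 1ᶜ *ᶜ z ≈ᶜ z
  *ᶜ-identityˡ z = mk≈ᶜ
    (solve 2 (λ a b → con 1ℚ :* a :- con 0ℚ :* b := a) ℝ-ring.refl (re z) (im z))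
    (solve 2 (λ a b → con 1ℚ :* b :+ con 0ℚ :* a := b) ℝ-ring.refl (re z) (im z))
    where open ℝ-Solver

  *ᶜ-distribˡ : ∀ z w v → z *ᶜ (w +ᶜ v) ≈ᶜ z *ᶜ w +ᶜ z *ᶜ v
  *ᶜ-distribˡ z w v = mk≈ᶜ
    (solve 6 (λ a b c d e f →
      a :* (c :+ e) :- b :* (d :+ f) := (a :* c :- b :* d) :+ (a :* e :- b :* f)) ℝ-ring.refl
      (re z) (im z) (re w) (im w) (re v) (im v))
    (solve 6 (λ a b c d e f →
      a :* (d :+ f) :+ b :* (c :+ e) := (a :* d :+ b :* c) :+ (a :* f :+ b :* e)) ℝ-ring.refl
      (re z) (im z) (re w) (im w) (re v) (im v))
    where open ℝ-Solver

  *ᶜ-cong : ∀ {z z′ w w′} → z ≈ᶜ z′ → w ≈ᶜ w′ → z *ᶜ w ≈ᶜ z′ *ᶜ w′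
  *ᶜ-cong (mk≈ᶜ p q) (mk≈ᶜ r s) = mk≈ᶜ
    (ℝ-ring.+-cong (ℝ-ring.*-cong p r) (ℝ-ring.-‿cong (ℝ-ring.*-cong q s)))
    (ℝ-ring.+-cong (ℝ-ring.*-cong p s) (ℝ-ring.*-cong q r))

  ≈ᶜ-isEquivalence : IsEquivalence _≈ᶜ_
  ≈ᶜ-isEquivalence = record
    { refl  = mk≈ᶜ ℝ-ring.refl ℝ-ring.refl
    ; sym   = λ (mk≈ᶜ p q) → mk≈ᶜ (ℝ-ring.sym p) (ℝ-ring.sym q)
    ; trans = λ (mk≈ᶜ p q) (mk≈ᶜ r s) → mk≈ᶜ (ℝ-ring.trans p r) (ℝ-ring.trans q s)
    }

  ≈ᶜ-setoid : Setoid 0ℓ 0ℓ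
  ≈ᶜ-setoid = record { isEquivalence = ≈ᶜ-isEquivalence }

ℂ-commutativeRing : CommutativeRing 0ℓ 0ℓ
ℂ-commutativeRing = record
  { Carrier = ℂ ; _≈_ = _≈ᶜ_ ; _+_ = _+ᶜ_ ; _*_ = _*ᶜ_ ; -_ = -ᶜ_ ; 0# = 0ᶜ ; 1# = 1ᶜ
  ; isCommutativeRing = record
    { isRing = record
      { +-isAbelianGroup = record
        { isGroup = record
          { isMonoid = record
            { isSemigroup = record
              { isMagma = record
                { isEquivalence = ≈ᶜ-isEquivalence
                ; ∙-cong = λ (mk≈ᶜ p q) (mk≈ᶜ r s) → mk≈ᶜ (ℝ-ring.+-cong p r) (ℝ-ring.+-cong q s)
                }
              ; assoc = λ z w v → mk≈ᶜ (ℝ-ring.+-assoc _ _ _) (ℝ-ring.+-assoc _ _ _)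
              }
            ; identity = (λ z → mk≈ᶜ (ℝ-ring.+-identityˡ _) (ℝ-ring.+-identityˡ _))
                       , (λ z → mk≈ᶜ (ℝ-ring.+-identityʳ _) (ℝ-ring.+-identityʳ _))
            }
          ; inverse = (λ z → mk≈ᶜ (ℝ-ring.-‿inverseˡ _) (ℝ-ring.-‿inverseˡ _))
                    , (λ z → mk≈ᶜ (ℝ-ring.-‿inverseʳ _) (ℝ-ring.-‿inverseʳ _))
          ; ⁻¹-cong = λ (mk≈ᶜ p q) → mk≈ᶜ (ℝ-ring.-‿cong p) (ℝ-ring.-‿cong q)
          }
        ; comm = λ z w → mk≈ᶜ (ℝ-ring.+-comm _ _) (ℝ-ring.+-comm _ _)
        }
      ; *-cong = *ᶜ-cong
      ; *-assoc = *ᶜ-assoc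
      ; *-identity = comm∧idˡ⇒id ≈ᶜ-setoid *ᶜ-comm *ᶜ-identityˡ
      ; distrib = comm∧distrˡ⇒distr ≈ᶜ-setoid
          (λ (mk≈ᶜ p q) (mk≈ᶜ r s) → mk≈ᶜ (ℝ-ring.+-cong p r) (ℝ-ring.+-cong q s)) *ᶜ-comm *ᶜ-distribˡ
      }
    ; *-comm = *ᶜ-comm
    }
  }

open RawSemiringDefs (Semiring.rawSemiring (CommutativeRing.semiring ℂ-commutativeRing))
  using (sum; _^_)

expPartialSum : ℂ → ℕ → ℂ
expPartialSum z n = sum {n} λ k →
  fromℝ (fromℚ ((ℤ.+ 1 ℚ./ toℕ k !) {{toℕ k !≢0}})) *ᶜ z ^ toℕ k

-- w = e^z: the exponential series at z converges to w.  Both sides of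
-- ∣expPartialSum z n − w∣ < ε are squared, which avoids square roots.
IsExp : ℂ → ℂ → Set
IsExp z w = ∀ ε → 0ℝ < ε → Eventually λ n → ∣ expPartialSum z n +ᶜ -ᶜ w ∣² < ε * ε

infix 4 _≈ᵛ_

_≈ᵛ_ : ∀ {n} → Vector ℂ n → Vector ℂ n → Set
u ≈ᵛ v = ∀ k → u k ≈ᶜ v k

⟨_,_⟩ : ∀ {n} → Vector ℂ n → Vector ℂ n → ℂ
⟨ u , v ⟩ = sum λ k → conj (u k) *ᶜ v k

-- ‖v‖ = 1, stated as ‖v‖² = 1.
IsUnit : ∀ {n} → Vector ℂ n → Set
IsUnit v = ⟨ v , v ⟩ ≈ᶜ 1ᶜ

linearCombination : ∀ {m n} → Vector ℂ m → Vector (Vector ℂ n) m → Vector ℂ n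
linearCombination c u k = sum λ j → c j *ᶜ u j k

LinearlyIndependent Spanning Orthonormal IsOrthonormalBasis :
  ∀ {m n} → Vector (Vector ℂ n) m → Set
LinearlyIndependent u = ∀ c → linearCombination c u ≈ᵛ (λ _ → 0ᶜ) → ∀ j → c j ≈ᶜ 0ᶜ
Spanning u            = ∀ v → ∃[ c ] v ≈ᵛ linearCombination c u
Orthonormal u         = (∀ i → IsUnit (u i)) × (∀ i j → i ≢ j → ⟨ u i , u j ⟩ ≈ᶜ 0ᶜ)
IsOrthonormalBasis u  = Orthonormal u × LinearlyIndependent u × Spanning u

SquareArray : ℕ → Set
SquareArray n = Fin n → Fin n → Vector ℂ n

record IsQuantumLatinSquare {n} (Φ : SquareArray n) : Set where
  field
    units   : ∀ i j → IsUnit (Φ i j)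
    rows    : ∀ i → IsOrthonormalBasis (λ j → Φ i j)
    columns : ∀ j → IsOrthonormalBasis (λ i → Φ i j)

-- u = e^{iα} v for some real α.
PhaseEquivalent : ∀ {n} → Vector ℂ n → Vector ℂ n → Set
PhaseEquivalent u v = ∃[ α ] ∃[ c ] (IsExp (𝕚 *ᶜ fromℝ α) c × u ≈ᵛ (λ k → c *ᶜ v k))

-- The cells, taken up to phase equivalence of their entries, are in bijection with Fin N.
HasCardinality : ∀ {n} → SquareArray n → ℕ → Set
HasCardinality {n} Φ N =
  ∃[ f ] (Congruent _∼_ _≡_ f × Bijective {B = Fin N} _∼_ _≡_ f)
  where
  _∼_ : Fin n × Fin n → Fin n × Fin n → Set
  p ∼ q = PhaseEquivalent (uncurry Φ p) (uncurry Φ q)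

module Entries (a b : ℝ) where

  𝓤 : ℝ → ℝ → ℝ → ℝ → Vector ℂ 6
  𝓤 t₀ t₁ t₂ t₃ k = fromℝ (lookup (t₀ ∷ t₁ ∷ t₂ ∷ t₃ ∷ 0ℝ ∷ 0ℝ ∷ []) k)

  𝓥 : ℝ → ℝ → Vector ℂ 6
  𝓥 t₄ t₅ k = fromℝ (lookup (0ℝ ∷ 0ℝ ∷ 0ℝ ∷ 0ℝ ∷ t₄ ∷ t₅ ∷ []) k)

  A B C D E F G H I J K L M N O P Q R S T U x y z w : Vector ℂ 6

  A = 𝓤 1ℝ 0ℝ 0ℝ 0ℝ
  B = 𝓤 0ℝ 1ℝ 0ℝ 0ℝ
  C = 𝓤 0ℝ 0ℝ 1ℝ 0ℝ
  D = 𝓤 0ℝ 0ℝ 0ℝ 1ℝ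
  E = 𝓤 0ℝ a (b * ρ) (b * ρ)
  F = 𝓤 a 0ℝ (b * ρ) (- (b * ρ))
  G = 𝓤 (b * ρ) (- (b * ρ)) 0ℝ a
  H = 𝓤 (- (b * ρ)) (- (b * ρ)) a 0ℝ
  I = 𝓤 0ℝ (- b) (a * ρ) (a * ρ)
  J = 𝓤 (- b) 0ℝ (a * ρ) (- (a * ρ))
  K = 𝓤 (- (a * ρ)) (a * ρ) 0ℝ b
  L = 𝓤 (a * ρ) (a * ρ) b 0ℝ
  M = 𝓤 (- (a * ρ)) (a * ρ) b 0ℝ
  N = 𝓤 (b * ρ) (- (b * ρ)) a 0ℝ
  O = 𝓤 ρ ρ 0ℝ 0ℝ
  P = 𝓤 (a * ρ) (a * ρ) 0ℝ b
  Q = 𝓤 (- (b * ρ)) (- (b * ρ)) 0ℝ a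
  R = 𝓤 (- ρ) ρ 0ℝ 0ℝ
  S = 𝓤 0ℝ 0ℝ ρ ρ
  T = 𝓤 b 0ℝ (a * ρ) (- (a * ρ))
  U = 𝓤 (- a) 0ℝ (b * ρ) (- (b * ρ))

  x = 𝓥 1ℝ 0ℝ
  y = 𝓥 0ℝ 1ℝ
  z = 𝓥 ρ ρ
  w = 𝓥 ρ (- ρ)

Φ : ℝ → ℝ → SquareArray 6
Φ a b i j = lookup (lookup
  ( (x ∷ A ∷ y ∷ B ∷ C ∷ D ∷ [])
  ∷ (y ∷ x ∷ E ∷ F ∷ G ∷ H ∷ [])
  ∷ (I ∷ y ∷ x ∷ J ∷ K ∷ L ∷ [])
  ∷ (M ∷ D ∷ N ∷ z ∷ O ∷ w ∷ [])
  ∷ (P ∷ C ∷ Q ∷ w ∷ z ∷ R ∷ [])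
  ∷ (T ∷ B ∷ U ∷ S ∷ w ∷ z ∷ [])
  ∷ []) i) j
  where open Entries a b

Φ₂₅ : SquareArray 6
Φ₂₅ = Φ (fromℚ (ℤ.+ 4 ℚ./ 5)) (fromℚ (ℤ.+ 3 ℚ./ 5))

{-# OPTIONS --safe #-}
-- Ten times every coordinate lies in ℤ[√2], so each orthonormality relation becomes an identity in
-- ℤ[√2] that evaluation decides.  A square matrix whose rows and columns are both orthonormal has
-- rows that span, by expanding v as ∑ ⟨uⱼ , v⟩ uⱼ.  If u = c v then all 2 × 2 minors
-- uₖ vₗ − uₗ vₖ vanish; for any two of the 25 letters some minor has non-zero norm, so only equal
-- letters are phase equivalent.
module Submission where

open import Defs
open import Algebra.Bundles using (CommutativeRing)
import Algebra.Properties.Ring as RingProperties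
import Algebra.Properties.Semiring.Sum as SemiringSum
import Algebra.Properties.Semiring.Exp as SemiringExp
open import Data.Fin.Base using (Fin; zero; suc; toℕ)
open import Data.Fin using (#_)
open import Data.Fin.Properties using (_≟_; all?; any?)
open import Data.Integer.Base as ℤ using (ℤ; 0ℤ)
import Data.Integer.Properties as ℤ
open import Data.Nat.Base as ℕ using (ℕ; zero; suc; _!)
import Data.Nat.Properties as ℕ
open import Data.Nat.Properties using (_!≢0)
open import Data.Product.Base using (_×_; _,_; ∃-syntax; proj₁; proj₂; uncurry)
open import Data.Product.Properties using (≡-dec)
open import Data.Rational.Base as ℚ using (ℚ; 0ℚ; 1ℚ; ½; toℚᵘ)
import Data.Rational.Properties as ℚ
open import Data.Rational.Solver using (module +-*-Solver)
open import Data.Integer.Solver using () renaming (module +-*-Solver to ℤ-Solver)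
open import Data.Rational.Unnormalised.Base as ℚᵘ using (mkℚᵘ; *≡*)
import Data.Rational.Unnormalised.Properties as ℚᵘ
open import Data.Sum.Base using (_⊎_; fromInj₁; inj₁; inj₂)
open import Data.Vec.Base as Vec using (Vec; []; _∷_; lookup)
open import Data.Vec.Functional using (Vector; foldr)
open import Data.Vec.Properties using (lookup-map)
open import Function.Base using (_∘_; flip)
open import Relation.Binary.Definitions using (DecidableEquality)
open import Relation.Binary.PropositionalEquality
  using (_≡_; _≢_; refl; sym; trans; cong; cong₂; subst)
import Relation.Binary.Reasoning.Setoid as SetoidReasoning
open import Relation.Nullary using (yes; no; contradiction)
open import Relation.Nullary.Decidable using (Dec; from-yes; ¬?; _⊎-dec_)

private
  module ℝᵣ = CommutativeRing ℝ-commutativeRing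
  module ℂᵣ = CommutativeRing ℂ-commutativeRing
  module ℝ-≈ = SetoidReasoning ℝᵣ.setoid
  module ℂ-≈ = SetoidReasoning ℂᵣ.setoid
  open SemiringSum ℂᵣ.semiring
    using (sum; sum-cong-≋; sum-replicate-zero; ∑-comm; *-distribˡ-sum)
  open SemiringExp ℂᵣ.semiring using (_^_)

-- Kronecker deltas and finite sums

module _ {A : Set} (one zer : A) where

  -- The two values are parameters because the same pattern occurs with 1 and 0 in ℂ and with 100
  -- and 0 in ℤ[√2]; `kronecker-map` passes between them.
  kronecker : ∀ {n} → Fin n → Fin n → A
  kronecker zero    zero    = one
  kronecker zero    (suc _) = zer
  kronecker (suc _) zero    = zer
  kronecker (suc i) (suc j) = kronecker i j

  kronecker-refl : ∀ {n} (i : Fin n) → kronecker i i ≡ one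
  kronecker-refl zero    = refl
  kronecker-refl (suc i) = kronecker-refl i

  kronecker-≢ : ∀ {n} {i j : Fin n} → i ≢ j → kronecker i j ≡ zer
  kronecker-≢ {i = zero}  {zero}  i≢j = contradiction refl i≢j
  kronecker-≢ {i = zero}  {suc _} _   = refl
  kronecker-≢ {i = suc _} {zero}  _   = refl
  kronecker-≢ {i = suc _} {suc _} i≢j = kronecker-≢ (i≢j ∘ cong suc)

  kronecker-sym : ∀ {n} (i j : Fin n) → kronecker i j ≡ kronecker j i
  kronecker-sym zero    zero    = refl
  kronecker-sym zero    (suc _) = refl
  kronecker-sym (suc _) zero    = refl
  kronecker-sym (suc i) (suc j) = kronecker-sym i j

kronecker-map : ∀ {A B : Set} (f : A → B) {o z} {n} (i j : Fin n) →
                f (kronecker o z i j) ≡ kronecker (f o) (f z) i j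
kronecker-map f zero    zero    = refl
kronecker-map f zero    (suc _) = refl
kronecker-map f (suc _) zero    = refl
kronecker-map f (suc i) (suc j) = kronecker-map f i j

δ : ∀ {n} → Fin n → Fin n → ℂ
δ = kronecker 1ᶜ 0ᶜ

sum-zero : ∀ {n} {f : Vector ℂ n} → (∀ i → f i ≈ᶜ 0ᶜ) → sum f ≈ᶜ 0ᶜ
sum-zero {n} f≈0 = ℂᵣ.trans (sum-cong-≋ f≈0) (sum-replicate-zero n)

sum-δ : ∀ {n} (f : Vector ℂ n) i → sum (λ k → f k *ᶜ δ i k) ≈ᶜ f i
sum-δ f zero    = ℂᵣ.trans
  (ℂᵣ.+-cong (ℂᵣ.*-identityʳ (f zero)) (sum-zero λ k → ℂᵣ.zeroʳ (f (suc k))))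
  (ℂᵣ.+-identityʳ (f zero))
sum-δ f (suc i) = ℂᵣ.trans
  (ℂᵣ.+-cong (ℂᵣ.zeroʳ (f zero)) (sum-δ (f ∘ suc) i))
  (ℂᵣ.+-identityˡ (f (suc i)))

*-sum-comm : ∀ {m n} (f : Vector ℂ m) (g : Fin m → Vector ℂ n) →
             sum (λ i → f i *ᶜ sum (g i)) ≈ᶜ sum (λ j → sum (λ i → f i *ᶜ g i j))
*-sum-comm f g = ℂᵣ.trans
  (sum-cong-≋ λ i → *-distribˡ-sum (f i) (g i))
  (∑-comm λ i j → f i *ᶜ g i j)

-- Orthonormal bases from Gram matrices

private
  x[yz]≈y[xz] : ∀ x y z → x *ᶜ (y *ᶜ z) ≈ᶜ y *ᶜ (x *ᶜ z)
  x[yz]≈y[xz] x y z = ℂᵣ.trans (ℂᵣ.sym (ℂᵣ.*-assoc x y z))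
    (ℂᵣ.trans (ℂᵣ.*-congʳ (ℂᵣ.*-comm x y)) (ℂᵣ.*-assoc y x z))

module _ {n} {u : Vector (Vector ℂ n) n}
  (orthonormal : ∀ i j → ⟨ u i , u j ⟩ ≈ᶜ δ i j)
  -- `flip u k` is the k-th column of the matrix with rows `u`, so this is the completeness
  -- relation.
  (complete    : ∀ k l → ⟨ flip u k , flip u l ⟩ ≈ᶜ δ k l)
  where

  private
    -- Pairing the combination with `u i` isolates `c i`; the chain reads this backwards, from `c i`
    -- to the pairing of `u i` with a vanishing vector.
    orthonormal⇒independent : LinearlyIndependent u
    orthonormal⇒independent c ∑≈0 i = begin
      c i                                                        ≈⟨ sum-δ c i ⟨
      sum (λ j → c j *ᶜ δ i j)
        ≈⟨ sum-cong-≋ (λ j → ℂᵣ.*-congˡ (orthonormal i j)) ⟨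
      sum (λ j → c j *ᶜ ⟨ u i , u j ⟩)
        ≈⟨ *-sum-comm c (λ j k → conj (u i k) *ᶜ u j k) ⟩
      sum (λ k → sum (λ j → c j *ᶜ (conj (u i k) *ᶜ u j k)))
        ≈⟨ sum-cong-≋ (λ k → sum-cong-≋ λ j → x[yz]≈y[xz] (c j) (conj (u i k)) (u j k)) ⟩
      sum (λ k → sum (λ j → conj (u i k) *ᶜ (c j *ᶜ u j k)))
        ≈⟨ sum-cong-≋ (λ k → *-distribˡ-sum (conj (u i k)) (λ j → c j *ᶜ u j k)) ⟨
      sum (λ k → conj (u i k) *ᶜ linearCombination c u k)
        ≈⟨ sum-zero (λ k → ℂᵣ.trans (ℂᵣ.*-congˡ (∑≈0 k)) (ℂᵣ.zeroʳ (conj (u i k)))) ⟩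
      0ᶜ                                                         ∎
      where open ℂ-≈

    -- The coefficients of `v` are its inner products with the `u j`. Once the sums are
    -- interchanged, the sum over j is an inner product of two columns, and `complete` collapses
    -- what remains to `v l`.
    complete⇒spanning : Spanning u
    complete⇒spanning v = (λ j → ⟨ u j , v ⟩) , λ l → ℂᵣ.sym (begin
      sum (λ j → ⟨ u j , v ⟩ *ᶜ u j l)
        ≈⟨ sum-cong-≋ (λ j → ℂᵣ.*-comm ⟨ u j , v ⟩ (u j l)) ⟩
      sum (λ j → u j l *ᶜ ⟨ u j , v ⟩)
        ≈⟨ *-sum-comm (λ j → u j l) (λ j k → conj (u j k) *ᶜ v k) ⟩
      sum (λ k → sum (λ j → u j l *ᶜ (conj (u j k) *ᶜ v k)))
        ≈⟨ sum-cong-≋ (λ k → sum-cong-≋ λ j → regroup (u j l) (conj (u j k)) (v k)) ⟩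
      sum (λ k → sum (λ j → v k *ᶜ (conj (u j k) *ᶜ u j l)))
        ≈⟨ sum-cong-≋ (λ k → *-distribˡ-sum (v k) (λ j → conj (u j k) *ᶜ u j l)) ⟨
      sum (λ k → v k *ᶜ ⟨ flip u k , flip u l ⟩)
        ≈⟨ sum-cong-≋ (λ k → ℂᵣ.*-congˡ {v k} (complete k l)) ⟩
      sum (λ k → v k *ᶜ δ k l)
        ≈⟨ sum-cong-≋ (λ k → ℂᵣ.*-congˡ {v k} (ℂᵣ.reflexive (kronecker-sym 1ᶜ 0ᶜ k l))) ⟩
      sum (λ k → v k *ᶜ δ l k)                                   ≈⟨ sum-δ v l ⟩
      v l                                                        ∎)
      where
      open ℂ-≈
      regroup : ∀ x y z → x *ᶜ (y *ᶜ z) ≈ᶜ z *ᶜ (y *ᶜ x)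
      regroup x y z = ℂᵣ.trans (ℂᵣ.*-comm x (y *ᶜ z))
        (ℂᵣ.trans (ℂᵣ.*-congʳ (ℂᵣ.*-comm y z)) (ℂᵣ.*-assoc z y x))

  orthonormal∧complete⇒basis : IsOrthonormalBasis u
  orthonormal∧complete⇒basis =
    ( (λ i → ℂᵣ.trans (orthonormal i i) (ℂᵣ.reflexive (kronecker-refl 1ᶜ 0ᶜ i)))
    , (λ i j i≢j → ℂᵣ.trans (orthonormal i j) (ℂᵣ.reflexive (kronecker-≢ 1ᶜ 0ᶜ i≢j))))
    , orthonormal⇒independent
    , complete⇒spanning

-- The exponential at zero and phase equivalence

p≤∣p∣ : ∀ p → p ℚ.≤ ℚ.∣ p ∣
p≤∣p∣ p with ℚ.≤-total 0ℚ p
... | inj₁ 0≤p = ℚ.≤-reflexive (sym (ℚ.0≤p⇒∣p∣≡p 0≤p))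
... | inj₂ p≤0 = ℚ.≤-trans p≤0 (ℚ.0≤∣p∣ p)

-- A strict inequality of reals needs a rational gap. If `ε` eventually exceeds γ > 0, half of γ²
-- serves: eventually r < γ²/2, hence r + γ²/2 < γ² < ε².
≈0⇒<square : ∀ {r ε} → r ≈ 0ℝ → 0ℝ < ε → r < ε * ε
≈0⇒<square {r} {ε} r≈0 (γ , γ>0 , N , γ<ε) = η , η>0 , N ℕ.⊔ M , λ n h →
  ℚ.<-trans (r+η<γ² n (r<η n (ℕ.≤-trans (ℕ.m≤n⊔m N M) h)))
    (γ²<ε² n (subst (ℚ._< seq ε n) (ℚ.+-identityˡ γ) (γ<ε n (ℕ.≤-trans (ℕ.m≤m⊔n N M) h))))
  where
  open +-*-Solver
  instance
    γ-pos = ℚ.positive γ>0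
    γ²-pos = ℚ.pos*pos⇒pos γ γ
    η-pos = ℚ.pos*pos⇒pos ½ (γ ℚ.* γ)
  η : ℚ
  η = ½ ℚ.* (γ ℚ.* γ)
  η>0 : 0ℚ ℚ.< η
  η>0 = ℚ.positive⁻¹ η
  r-small = close r≈0 η η>0
  M = proj₁ r-small
  r<η = proj₂ r-small
  r+η<γ² : ∀ n → ℚ.∣ seq r n ℚ.- 0ℚ ∣ ℚ.< η → seq r n ℚ.+ η ℚ.< γ ℚ.* γ
  r+η<γ² n h = subst (seq r n ℚ.+ η ℚ.<_)
    (solve 1 (λ d → con ½ :* d :+ con ½ :* d := d) refl (γ ℚ.* γ))
    (ℚ.+-monoˡ-< η (ℚ.≤-<-trans (p≤∣p∣ (seq r n))
      (subst (λ t → ℚ.∣ t ∣ ℚ.< η) (ℚ.+-identityʳ (seq r n)) h)))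
  γ²<ε² : ∀ n → γ ℚ.< seq ε n → γ ℚ.* γ ℚ.< seq ε n ℚ.* seq ε n
  γ²<ε² n h = ℚ.<-trans (ℚ.*-monoʳ-<-pos γ h)
    (ℚ.*-monoˡ-<-pos (seq ε n) {{ℚ.positive (ℚ.<-trans γ>0 h)}} h)

-- Only the constant term survives, since every later power contains the factor `z`.
expPartialSum-zero : ∀ {z} n → z ≈ᶜ 0ᶜ → expPartialSum z (suc n) ≈ᶜ 1ᶜ
expPartialSum-zero {z} n z≈0 = ℂᵣ.trans
  (ℂᵣ.+-cong (ℂᵣ.*-identityˡ 1ᶜ) (sum-zero {n} {λ k → 1/ suc (toℕ k) ! *ᶜ z ^ suc (toℕ k)} λ k →
    ℂᵣ.trans (ℂᵣ.*-congˡ {1/ suc (toℕ k) !} (ℂᵣ.trans (ℂᵣ.*-congʳ z≈0) (ℂᵣ.zeroˡ (z ^ toℕ k))))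
      (ℂᵣ.zeroʳ (1/ suc (toℕ k) !))))
  (ℂᵣ.+-identityʳ 1ᶜ)
  where
  1/_! : ℕ → ℂ
  1/ k ! = fromℝ (fromℚ ((ℤ.+ 1 ℚ./ k !) {{k !≢0}}))

∣∣²-zero : ∀ {z} → z ≈ᶜ 0ᶜ → ∣ z ∣² ≈ 0ℝ
∣∣²-zero z≈0 = ℝᵣ.trans
  (ℝᵣ.+-cong (ℝᵣ.*-cong (re≈ z≈0) (re≈ z≈0)) (ℝᵣ.*-cong (im≈ z≈0) (im≈ z≈0)))
  (ℝᵣ.trans (ℝᵣ.+-cong (ℝᵣ.zeroˡ 0ℝ) (ℝᵣ.zeroˡ 0ℝ)) (ℝᵣ.+-identityˡ 0ℝ))

isExp-zero : ∀ {z} → z ≈ᶜ 0ᶜ → IsExp z 1ᶜ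
-- The threshold is 1 because the empty partial sum is 0; from then on the error vanishes.
isExp-zero z≈0 ε ε>0 = 1 , λ where
  (suc n) _ → ≈0⇒<square {ε = ε} (∣∣²-zero
    (ℂᵣ.trans (ℂᵣ.+-congʳ (expPartialSum-zero n z≈0)) (ℂᵣ.-‿inverseʳ 1ᶜ))) ε>0

≡⇒phaseEquivalent : ∀ {n} {u v : Vector ℂ n} → u ≡ v → PhaseEquivalent u v
≡⇒phaseEquivalent {u = u} refl =
  -- The angle 0 has phase 1.
  0ℝ , 1ᶜ , isExp-zero (ℂᵣ.zeroʳ 𝕚) , λ k → ℂᵣ.sym (ℂᵣ.*-identityˡ (u k))

-- Both sides equal c vₖ vₗ. This eliminates the unknown phase and leaves a relation between
-- coordinates alone.
phaseEquivalent⇒proportional : ∀ {n} {u v : Vector ℂ n} → PhaseEquivalent u v →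
                               ∀ k l → u k *ᶜ v l ≈ᶜ u l *ᶜ v k
phaseEquivalent⇒proportional {u = u} {v} (_ , c , _ , u≈cv) k l = begin
  u k *ᶜ v l          ≈⟨ ℂᵣ.*-congʳ (u≈cv k) ⟩
  (c *ᶜ v k) *ᶜ v l   ≈⟨ ℂᵣ.*-assoc c (v k) (v l) ⟩
  c *ᶜ (v k *ᶜ v l)   ≈⟨ ℂᵣ.*-congˡ (ℂᵣ.*-comm (v k) (v l)) ⟩
  c *ᶜ (v l *ᶜ v k)   ≈⟨ ℂᵣ.*-assoc c (v l) (v k) ⟨
  (c *ᶜ v l) *ᶜ v k   ≈⟨ ℂᵣ.*-congʳ (u≈cv l) ⟨
  u l *ᶜ v k          ∎
  where open ℂ-≈

-- Integers inside the reals

-- `ℚ./` divides by a gcd, which does not compute on variables, so the identity is checked on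
-- unnormalised fractions with denominator 1.
/1-homo-+ : ∀ i j → (i ℤ.+ j) ℚ./ 1 ≡ i ℚ./ 1 ℚ.+ j ℚ./ 1
/1-homo-+ i j = ℚ.toℚᵘ-injective (begin
  toℚᵘ ((i ℤ.+ j) ℚ./ 1)                  ≈⟨ ℚ.toℚᵘ-fromℚᵘ (mkℚᵘ (i ℤ.+ j) 0) ⟩
  mkℚᵘ (i ℤ.+ j) 0
    ≈⟨ *≡* (cong (ℤ._* ℤ.+ 1) (cong₂ ℤ._+_ (ℤ.*-identityʳ i) (ℤ.*-identityʳ j))) ⟨
  mkℚᵘ i 0 ℚᵘ.+ mkℚᵘ j 0
    ≈⟨ ℚᵘ.+-cong (ℚ.toℚᵘ-fromℚᵘ (mkℚᵘ i 0)) (ℚ.toℚᵘ-fromℚᵘ (mkℚᵘ j 0)) ⟨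
  toℚᵘ (i ℚ./ 1) ℚᵘ.+ toℚᵘ (j ℚ./ 1)      ≈⟨ ℚ.toℚᵘ-homo-+ (i ℚ./ 1) (j ℚ./ 1) ⟨
  toℚᵘ (i ℚ./ 1 ℚ.+ j ℚ./ 1)              ∎)
  where open SetoidReasoning ℚᵘ.≃-setoid

/1-homo-* : ∀ i j → (i ℤ.* j) ℚ./ 1 ≡ (i ℚ./ 1) ℚ.* (j ℚ./ 1)
/1-homo-* i j = ℚ.toℚᵘ-injective (begin
  toℚᵘ ((i ℤ.* j) ℚ./ 1)                  ≈⟨ ℚ.toℚᵘ-fromℚᵘ (mkℚᵘ (i ℤ.* j) 0) ⟩
  mkℚᵘ i 0 ℚᵘ.* mkℚᵘ j 0
    ≈⟨ ℚᵘ.*-cong (ℚ.toℚᵘ-fromℚᵘ (mkℚᵘ i 0)) (ℚ.toℚᵘ-fromℚᵘ (mkℚᵘ j 0)) ⟨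
  toℚᵘ (i ℚ./ 1) ℚᵘ.* toℚᵘ (j ℚ./ 1)      ≈⟨ ℚ.toℚᵘ-homo-* (i ℚ./ 1) (j ℚ./ 1) ⟨
  toℚᵘ ((i ℚ./ 1) ℚ.* (j ℚ./ 1))          ∎)
  where open SetoidReasoning ℚᵘ.≃-setoid

/1-homo-neg : ∀ i → (ℤ.- i) ℚ./ 1 ≡ ℚ.- (i ℚ./ 1)
/1-homo-neg i = ℚ.toℚᵘ-injective (begin
  toℚᵘ ((ℤ.- i) ℚ./ 1)    ≈⟨ ℚ.toℚᵘ-fromℚᵘ (mkℚᵘ (ℤ.- i) 0) ⟩
  ℚᵘ.- mkℚᵘ i 0           ≈⟨ ℚᵘ.-‿cong (ℚ.toℚᵘ-fromℚᵘ (mkℚᵘ i 0)) ⟨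
  ℚᵘ.- toℚᵘ (i ℚ./ 1)     ≈⟨ ℚ.toℚᵘ-homo‿- (i ℚ./ 1) ⟨
  toℚᵘ (ℚ.- (i ℚ./ 1))    ∎)
  where open SetoidReasoning ℚᵘ.≃-setoid

fromℚ≈0⇒≡0 : ∀ {p} → fromℚ p ≈ 0ℝ → p ≡ 0ℚ
fromℚ≈0⇒≡0 {p} p≈0 with p ℚ.≟ 0ℚ
... | yes p≡0 = p≡0
... | no  p≢0 =
  -- With |p| itself as tolerance, the constant sequence would give |p| < |p|.
  let N , ∣p∣<∣p∣ = close p≈0 ℚ.∣ p ∣ 0<∣p∣
  in contradiction
    (subst (λ q → ℚ.∣ q ∣ ℚ.< ℚ.∣ p ∣) (ℚ.+-identityʳ p) (∣p∣<∣p∣ N ℕ.≤-refl))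
    (ℚ.<-irrefl refl)
  where
  0<∣p∣ : 0ℚ ℚ.< ℚ.∣ p ∣
  0<∣p∣ = ℚ.≰⇒> λ ∣p∣≤0 → p≢0 (ℚ.∣p∣≡0⇒p≡0 p (ℚ.≤-antisym ∣p∣≤0 (ℚ.0≤∣p∣ p)))

fromℤ : ℤ → ℝ
fromℤ i = fromℚ (i ℚ./ 1)

fromℤ-+ : ∀ i j → fromℤ (i ℤ.+ j) ≈ fromℤ i + fromℤ j
fromℤ-+ i j = ℝᵣ.trans (ℝᵣ.reflexive (cong fromℚ (/1-homo-+ i j))) (fromℚ-+ (i ℚ./ 1) (j ℚ./ 1))

fromℤ-* : ∀ i j → fromℤ (i ℤ.* j) ≈ fromℤ i * fromℤ j
fromℤ-* i j = ℝᵣ.trans (ℝᵣ.reflexive (cong fromℚ (/1-homo-* i j))) (fromℚ-* (i ℚ./ 1) (j ℚ./ 1))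

fromℤ-neg : ∀ i → fromℤ (ℤ.- i) ≈ - fromℤ i
fromℤ-neg i = ℝᵣ.trans (ℝᵣ.reflexive (cong fromℚ (/1-homo-neg i))) (fromℚ-neg (i ℚ./ 1))

fromℤ≈0⇒≡0 : ∀ {i} → fromℤ i ≈ 0ℝ → i ≡ 0ℤ
fromℤ≈0⇒≡0 {i} i≈0
  with *≡* eq ← ℚᵘ.≃-trans (ℚᵘ.≃-sym (ℚ.toℚᵘ-fromℚᵘ (mkℚᵘ i 0)))
    (ℚ.toℚᵘ-cong (fromℚ≈0⇒≡0 {i ℚ./ 1} i≈0))
  = trans (sym (ℤ.*-identityʳ i)) eq

-- The ring ℤ[√2] and its norm

√2 : ℝ
√2 = ρ + ρ

-- Since `ρ` is 1/√2, its double is √2, and the square is four times `ρ*ρ≈½`.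
√2*√2≈2 : √2 * √2 ≈ fromℤ (ℤ.+ 2)
√2*√2≈2 = begin
  √2 * √2
    ≈⟨ solve 1 (λ r → (r :+ r) :* (r :+ r) := con (ℤ.+ 4 ℚ./ 1) :* (r :* r)) ℝᵣ.refl ρ ⟩
  fromℤ (ℤ.+ 4) * (ρ * ρ)        ≈⟨ ℝᵣ.*-congˡ ρ*ρ≈½ ⟩
  fromℤ (ℤ.+ 4) * fromℚ ½        ≈⟨ solve 0 (con (ℤ.+ 4 ℚ./ 1) :* con ½ := con (ℤ.+ 2 ℚ./ 1)) ℝᵣ.refl ⟩
  fromℤ (ℤ.+ 2)                  ∎
  where
  open ℝ-≈
  open ℝ-Solver

-- (p , q) stands for p + q√2.
ℤ[√2] : Set
ℤ[√2] = ℤ × ℤ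

infixl 6 _⊕_
infixl 7 _⊗_
infix  8 ⊖_

_⊕_ _⊗_ : ℤ[√2] → ℤ[√2] → ℤ[√2]
(p , q) ⊕ (p′ , q′) = p ℤ.+ p′ , q ℤ.+ q′
(p , q) ⊗ (p′ , q′) = p ℤ.* p′ ℤ.+ ℤ.+ 2 ℤ.* (q ℤ.* q′) , p ℤ.* q′ ℤ.+ q ℤ.* p′

⊖_ conjugate : ℤ[√2] → ℤ[√2]
⊖ (p , q)         = ℤ.- p , ℤ.- q
conjugate (p , q) = p , ℤ.- q

norm : ℤ[√2] → ℤ
norm (p , q) = p ℤ.* p ℤ.- ℤ.+ 2 ℤ.* (q ℤ.* q)

𝟘 : ℤ[√2]
𝟘 = 0ℤ , 0ℤ

_≟ᶻ_ : DecidableEquality ℤ[√2]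
_≟ᶻ_ = ≡-dec ℤ._≟_ ℤ._≟_

ι : ℤ[√2] → ℝ
ι (p , q) = fromℤ p + fromℤ q * √2

ι-⊕ : ∀ s t → ι (s ⊕ t) ≈ ι s + ι t
ι-⊕ (p , q) (p′ , q′) = ℝᵣ.trans
  (ℝᵣ.+-cong (fromℤ-+ p p′) (ℝᵣ.*-congʳ {√2} (fromℤ-+ q q′)))
  (solve 5 (λ a b c d s → (a :+ c) :+ (b :+ d) :* s := (a :+ b :* s) :+ (c :+ d :* s)) ℝᵣ.refl
    (fromℤ p) (fromℤ q) (fromℤ p′) (fromℤ q′) √2)
  where open ℝ-Solver

ι-⊖ : ∀ s → ι (⊖ s) ≈ - ι s
ι-⊖ (p , q) = ℝᵣ.trans
  (ℝᵣ.+-cong (fromℤ-neg p) (ℝᵣ.*-congʳ {√2} (fromℤ-neg q)))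
  (solve 3 (λ a b s → :- a :+ :- b :* s := :- (a :+ b :* s)) ℝᵣ.refl (fromℤ p) (fromℤ q) √2)
  where open ℝ-Solver

ι-⊗ : ∀ s t → ι (s ⊗ t) ≈ ι s * ι t
ι-⊗ (p , q) (p′ , q′) = begin
  fromℤ (p ℤ.* p′ ℤ.+ ℤ.+ 2 ℤ.* (q ℤ.* q′)) + fromℤ (p ℤ.* q′ ℤ.+ q ℤ.* p′) * √2
    ≈⟨ ℝᵣ.+-cong
         (ℝᵣ.trans (fromℤ-+ (p ℤ.* p′) (ℤ.+ 2 ℤ.* (q ℤ.* q′))) (ℝᵣ.+-cong (fromℤ-* p p′)
           (ℝᵣ.trans (fromℤ-* (ℤ.+ 2) (q ℤ.* q′))
             -- The constant 2 of `_⊗_` is turned back into `√2 * √2`, after which both sides agree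
             -- as polynomials.
             (ℝᵣ.*-cong (ℝᵣ.sym √2*√2≈2) (fromℤ-* q q′)))))
         (ℝᵣ.*-congʳ {√2} (ℝᵣ.trans (fromℤ-+ (p ℤ.* q′) (q ℤ.* p′))
           (ℝᵣ.+-cong (fromℤ-* p q′) (fromℤ-* q p′)))) ⟩
  (a * c + (√2 * √2) * (b * d)) + (a * d + b * c) * √2
    ≈⟨ solve 5 (λ a b c d s → (a :* c :+ (s :* s) :* (b :* d)) :+ (a :* d :+ b :* c) :* s
                             := (a :+ b :* s) :* (c :+ d :* s)) ℝᵣ.refl a b c d √2 ⟩
  (a + b * √2) * (c + d * √2) ∎
  where
  open ℝ-≈
  open ℝ-Solver
  a = fromℤ p
  b = fromℤ q
  c = fromℤ p′
  d = fromℤ q′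

⊗-conjugate : ∀ s → s ⊗ conjugate s ≡ (norm s , 0ℤ)
⊗-conjugate (p , q) = cong₂ _,_
  (solve 2 (λ p q → p :* p :+ con (ℤ.+ 2) :* (q :* :- q) := p :* p :- con (ℤ.+ 2) :* (q :* q)) refl p q)
  (solve 2 (λ p q → p :* :- q :+ q :* p := con 0ℤ) refl p q)
  where open ℤ-Solver

-- The norm is `s` times its conjugate, so it vanishes with `s`. Equality of reals thereby becomes
-- an integer equation, and stopping at the norm avoids an appeal to the irrationality of √2.
ι≈0⇒norm≡0 : ∀ s → ι s ≈ 0ℝ → norm s ≡ 0ℤ
ι≈0⇒norm≡0 s s≈0 = fromℤ≈0⇒≡0 (begin
  fromℤ (norm s)              ≈⟨ solve 2 (λ n s → n := n :+ con 0ℚ :* s) ℝᵣ.refl (fromℤ (norm s)) √2 ⟩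
  ι (norm s , 0ℤ)             ≡⟨ cong ι (⊗-conjugate s) ⟨
  ι (s ⊗ conjugate s)         ≈⟨ ι-⊗ s (conjugate s) ⟩
  ι s * ι (conjugate s)       ≈⟨ ℝᵣ.*-congʳ s≈0 ⟩
  0ℝ * ι (conjugate s)        ≈⟨ ℝᵣ.zeroˡ (ι (conjugate s)) ⟩
  0ℝ                          ∎)
  where
  open ℝ-≈
  open ℝ-Solver

-- Vectors with coordinates in a tenth of ℤ[√2]

1/10 1/100 : ℝ
1/10  = fromℚ (ℤ.+ 1 ℚ./ 10)
1/100 = fromℚ (ℤ.+ 1 ℚ./ 100)

-- Coordinates are scaled by 1/10, so their products are scaled by 1/100.
ψ : ℤ[√2] → ℂ
ψ s = fromℝ (1/100 * ι s)

ψ-⊕ : ∀ s t → ψ (s ⊕ t) ≈ᶜ ψ s +ᶜ ψ t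
ψ-⊕ s t = mk≈ᶜ (ℝᵣ.trans (ℝᵣ.*-congˡ (ι-⊕ s t)) (ℝᵣ.distribˡ 1/100 (ι s) (ι t)))
  (ℝᵣ.sym (ℝᵣ.+-identityˡ 0ℝ))

ψ-𝟘 : ψ 𝟘 ≈ᶜ 0ᶜ
ψ-𝟘 = mk≈ᶜ (solve 1 (λ s → con (ℤ.+ 1 ℚ./ 100) :* (con 0ℚ :+ con 0ℚ :* s) := con 0ℚ) ℝᵣ.refl √2) ℝᵣ.refl
  where open ℝ-Solver

ψ-100 : ψ (ℤ.+ 100 , 0ℤ) ≈ᶜ 1ᶜ
ψ-100 = mk≈ᶜ
  (solve 1 (λ s → con (ℤ.+ 1 ℚ./ 100) :* (con (ℤ.+ 100 ℚ./ 1) :+ con 0ℚ :* s) := con 1ℚ) ℝᵣ.refl √2) ℝᵣ.refl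
  where open ℝ-Solver

infix 4 _≈/10_

-- A record, so that both vectors can be inferred from a proof.
record _≈/10_ {n} (u : Vector ℂ n) (x : Vector ℤ[√2] n) : Set where
  constructor mk≈/10
  field
    scaled : ∀ k → u k ≈ᶜ fromℝ (1/10 * ι (x k))

open _≈/10_

ψ-⊗ : ∀ s t → fromℝ (1/10 * ι s) *ᶜ fromℝ (1/10 * ι t) ≈ᶜ ψ (s ⊗ t)
ψ-⊗ s t = mk≈ᶜ
  (ℝᵣ.trans
    (solve 2 (λ a b → (con (ℤ.+ 1 ℚ./ 10) :* a) :* (con (ℤ.+ 1 ℚ./ 10) :* b) :- con 0ℚ :* con 0ℚ
                    := con (ℤ.+ 1 ℚ./ 100) :* (a :* b)) ℝᵣ.refl (ι s) (ι t))
    (ℝᵣ.*-congˡ (ℝᵣ.sym (ι-⊗ s t))))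
  (solve 2 (λ a b → a :* con 0ℚ :+ con 0ℚ :* b := con 0ℚ) ℝᵣ.refl (1/10 * ι s) (1/10 * ι t))
  where open ℝ-Solver

conj-cong : ∀ {z w} → z ≈ᶜ w → conj z ≈ᶜ conj w
conj-cong z≈w = mk≈ᶜ (re≈ z≈w) (ℝᵣ.-‿cong (im≈ z≈w))

conj-fromℝ : ∀ r → conj (fromℝ r) ≈ᶜ fromℝ r
conj-fromℝ r = mk≈ᶜ ℝᵣ.refl (ℝᵣ.sym (fromℚ-neg 0ℚ))

ψ≈ψ⇒norm≡0 : ∀ s t → ψ s ≈ᶜ ψ t → norm (s ⊕ ⊖ t) ≡ 0ℤ
ψ≈ψ⇒norm≡0 s t ψs≈ψt = ι≈0⇒norm≡0 (s ⊕ ⊖ t) (begin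
  ι (s ⊕ ⊖ t)               ≈⟨ ℝᵣ.trans (ι-⊕ s (⊖ t)) (ℝᵣ.+-congˡ (ι-⊖ t)) ⟩
  ι s + - ι t
    -- The factor 100 undoes the scaling in `ψ`.
    ≈⟨ solve 2 (λ a b → a :- b
                          := con (ℤ.+ 100 ℚ./ 1) :* (con (ℤ.+ 1 ℚ./ 100) :* a :- con (ℤ.+ 1 ℚ./ 100) :* b)) ℝᵣ.refl (ι s) (ι t) ⟩
  fromℤ (ℤ.+ 100) * (1/100 * ι s + - (1/100 * ι t))
                            ≈⟨ ℝᵣ.*-congˡ (ℝᵣ.+-congʳ (re≈ ψs≈ψt)) ⟩
  fromℤ (ℤ.+ 100) * (1/100 * ι t + - (1/100 * ι t))
                            ≈⟨ solve 1 (λ a → con (ℤ.+ 100 ℚ./ 1) :* (a :- a) := con 0ℚ) ℝᵣ.refl (1/100 * ι t) ⟩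
  0ℝ                        ∎)
  where
  open ℝ-≈
  open ℝ-Solver

dot : ∀ {n} → Vector ℤ[√2] n → Vector ℤ[√2] n → ℤ[√2]
dot x y = foldr _⊕_ 𝟘 λ k → x k ⊗ y k

ψ-sum : ∀ {n} (x : Vector ℤ[√2] n) → sum (λ k → ψ (x k)) ≈ᶜ ψ (foldr _⊕_ 𝟘 x)
ψ-sum {zero}  x = ℂᵣ.sym ψ-𝟘
ψ-sum {suc n} x = ℂᵣ.trans (ℂᵣ.+-congˡ (ψ-sum (x ∘ suc)))
  (ℂᵣ.sym (ψ-⊕ (x zero) (foldr _⊕_ 𝟘 (x ∘ suc))))

-- The coordinates are real, so conjugation acts trivially and the Hermitian product becomes
-- bilinear.
⟨,⟩≈ψ-dot : ∀ {n} {u v : Vector ℂ n} {x y} → u ≈/10 x → v ≈/10 y → ⟨ u , v ⟩ ≈ᶜ ψ (dot x y)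
⟨,⟩≈ψ-dot {x = x} {y} u≈x v≈y = ℂᵣ.trans
  (sum-cong-≋ λ k → ℂᵣ.trans
    (ℂᵣ.*-cong (ℂᵣ.trans (conj-cong (scaled u≈x k)) (conj-fromℝ (1/10 * ι (x k)))) (scaled v≈y k))
    (ψ-⊗ (x k) (y k)))
  (ψ-sum λ k → x k ⊗ y k)

-- A unit vector scaled by ten has squared length 100.
Orthogonal : ∀ {n} → Vector (Vector ℤ[√2] n) n → Set
Orthogonal e = ∀ i j → dot (e i) (e j) ≡ kronecker (ℤ.+ 100 , 0ℤ) 𝟘 i j

orthogonal? : ∀ {n} (e : Vector (Vector ℤ[√2] n) n) → Dec (Orthogonal e)
orthogonal? e = all? λ i → all? λ j → dot (e i) (e j) ≟ᶻ kronecker (ℤ.+ 100 , 0ℤ) 𝟘 i j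

gram-δ : ∀ {n} {u : Vector (Vector ℂ n) n} {e : Vector (Vector ℤ[√2] n) n} →
         (∀ i → u i ≈/10 e i) → Orthogonal e →
         ∀ i j → ⟨ u i , u j ⟩ ≈ᶜ δ i j
gram-δ {u = u} {e} u≈e orthogonal i j = begin
  ⟨ u i , u j ⟩                          ≈⟨ ⟨,⟩≈ψ-dot (u≈e i) (u≈e j) ⟩
  ψ (dot (e i) (e j))                    ≡⟨ cong ψ (orthogonal i j) ⟩
  ψ (kronecker (ℤ.+ 100 , 0ℤ) 𝟘 i j)     ≡⟨ kronecker-map ψ i j ⟩
  kronecker (ψ (ℤ.+ 100 , 0ℤ)) (ψ 𝟘) i j ≈⟨ kronecker-cong i j ⟩
  δ i j                                  ∎
  where
  open ℂ-≈
  kronecker-cong : ∀ {n} (i j : Fin n) → kronecker (ψ (ℤ.+ 100 , 0ℤ)) (ψ 𝟘) i j ≈ᶜ δ i j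
  kronecker-cong zero    zero    = ψ-100
  kronecker-cong zero    (suc _) = ψ-𝟘
  kronecker-cong (suc _) zero    = ψ-𝟘
  kronecker-cong (suc i) (suc j) = kronecker-cong i j

orthogonal⇒basis : ∀ {n} {u : Vector (Vector ℂ n) n} {e : Vector (Vector ℤ[√2] n) n} →
                   (∀ i → u i ≈/10 e i) →
                   Orthogonal e → Orthogonal (flip e) → IsOrthonormalBasis u
orthogonal⇒basis {e = e} u≈e rows columns = orthonormal∧complete⇒basis
  (gram-δ u≈e rows)
  (gram-δ {e = flip e} (λ k → mk≈/10 λ j → scaled (u≈e j) k) columns)

-- Proportional vectors have vanishing 2 × 2 minors. The conclusion lives in ℤ, where evaluating one
-- minor can refute it.
phaseEquivalent⇒minors : ∀ {n} {u v : Vector ℂ n} {x y} → u ≈/10 x → v ≈/10 y →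
                         PhaseEquivalent u v → ∀ k l → norm (x k ⊗ y l ⊕ ⊖ (x l ⊗ y k)) ≡ 0ℤ
phaseEquivalent⇒minors {u = u} {v} {x} {y} u≈x v≈y u∼v k l =
  ψ≈ψ⇒norm≡0 (x k ⊗ y l) (x l ⊗ y k) (begin
    ψ (x k ⊗ y l)   ≈⟨ product k l ⟨
    u k *ᶜ v l      ≈⟨ phaseEquivalent⇒proportional u∼v k l ⟩
    u l *ᶜ v k      ≈⟨ product l k ⟩
    ψ (x l ⊗ y k)   ∎)
  where
  open ℂ-≈
  product : ∀ k l → u k *ᶜ v l ≈ᶜ ψ (x k ⊗ y l)
  product k l = ℂᵣ.trans (ℂᵣ.*-cong (scaled u≈x k) (scaled v≈y l)) (ψ-⊗ (x k) (y l))

-- Symbolic coordinates and the 25 letters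

data Magnitude : Set where
  one rho a b aρ bρ : Magnitude

-- Symbols have two readings: `⟦_⟧` in ℝ, matching the given array, and `_×10` in ℤ[√2], where
-- equality is decidable.
data Coordinate : Set where
  𝟎       : Coordinate
  pos neg : Magnitude → Coordinate

magnitude : Magnitude → ℝ
magnitude one = 1ℝ
magnitude rho = ρ
magnitude a   = fromℚ (ℤ.+ 4 ℚ./ 5)
magnitude b   = fromℚ (ℤ.+ 3 ℚ./ 5)
magnitude aρ  = fromℚ (ℤ.+ 4 ℚ./ 5) * ρ
magnitude bρ  = fromℚ (ℤ.+ 3 ℚ./ 5) * ρ

⟦_⟧ : Coordinate → ℝ
⟦ 𝟎 ⟧     = 0ℝ
⟦ pos m ⟧ = magnitude m
⟦ neg m ⟧ = - magnitude m

-- Ten clears both the 5 in the denominators of 4/5 and 3/5 and the 2 in ρ = √2/2.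
magnitude×10 : Magnitude → ℤ[√2]
magnitude×10 one = ℤ.+ 10 , 0ℤ
magnitude×10 rho = 0ℤ , ℤ.+ 5
magnitude×10 a   = ℤ.+ 8 , 0ℤ
magnitude×10 b   = ℤ.+ 6 , 0ℤ
magnitude×10 aρ  = 0ℤ , ℤ.+ 4
magnitude×10 bρ  = 0ℤ , ℤ.+ 3

_×10 : Coordinate → ℤ[√2]
𝟎     ×10 = 𝟘
pos m ×10 = magnitude×10 m
neg m ×10 = ⊖ magnitude×10 m

magnitude≈ : ∀ m → magnitude m ≈ 1/10 * ι (magnitude×10 m)
magnitude≈ = λ where
    one → solve 1 (λ r → con 1ℚ                 := tenth 10 0 r) ℝᵣ.refl ρ
    rho → solve 1 (λ r → r                      := tenth 0 5 r) ℝᵣ.refl ρ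
    a   → solve 1 (λ r → con (ℤ.+ 4 ℚ./ 5)      := tenth 8 0 r) ℝᵣ.refl ρ
    b   → solve 1 (λ r → con (ℤ.+ 3 ℚ./ 5)      := tenth 6 0 r) ℝᵣ.refl ρ
    aρ  → solve 1 (λ r → con (ℤ.+ 4 ℚ./ 5) :* r := tenth 0 4 r) ℝᵣ.refl ρ
    bρ  → solve 1 (λ r → con (ℤ.+ 3 ℚ./ 5) :* r := tenth 0 3 r) ℝᵣ.refl ρ
  where
  open ℝ-Solver
  tenth : ∀ {n} → ℕ → ℕ → Polynomial n → Polynomial n
  -- `√2` is spelled out as r + r, so that the solver sees polynomials in `ρ` alone.
  tenth p q r = con (ℤ.+ 1 ℚ./ 10) :* (con (ℤ.+ p ℚ./ 1) :+ con (ℤ.+ q ℚ./ 1) :* (r :+ r))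

coordinate≈ : ∀ c → ⟦ c ⟧ ≈ 1/10 * ι (c ×10)
coordinate≈ 𝟎       =
  solve 1 (λ s → con 0ℚ := con (ℤ.+ 1 ℚ./ 10) :* (con 0ℚ :+ con 0ℚ :* s)) ℝᵣ.refl √2
  where open ℝ-Solver
coordinate≈ (pos m) = magnitude≈ m
coordinate≈ (neg m) = begin
  - magnitude m                         ≈⟨ ℝᵣ.-‿cong (magnitude≈ m) ⟩
  - (1/10 * ι (magnitude×10 m))         ≈⟨ -‿distribʳ-* 1/10 (ι (magnitude×10 m)) ⟩
  1/10 * - ι (magnitude×10 m)           ≈⟨ ℝᵣ.*-congˡ (ι-⊖ (magnitude×10 m)) ⟨
  1/10 * ι (⊖ magnitude×10 m)           ∎
  where
  open ℝ-≈
  open RingProperties ℝᵣ.ring using (-‿distribʳ-*)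

Coordinates : Set
Coordinates = Vec Coordinate 6

-- Mapping before the lookup makes a concrete letter unfold to the very vector used in `Φ`.
entry : Coordinates → Vector ℂ 6
entry v k = fromℝ (lookup (Vec.map ⟦_⟧ v) k)

entry×10 : Coordinates → Vector ℤ[√2] 6
entry×10 v k = lookup v k ×10

entry≈ : ∀ v → entry v ≈/10 entry×10 v
entry≈ v .scaled k = ℂᵣ.trans
  (ℂᵣ.reflexive (cong fromℝ (lookup-map k ⟦_⟧ v)))
  (mk≈ᶜ (coordinate≈ (lookup v k)) ℝᵣ.refl)

-- The letters A, …, U are numbered 0, …, 20, and x, y, z, w are numbered 21, …, 24.
letters : Vec Coordinates 25
letters
  = 𝓤 (pos one) 𝟎 𝟎 𝟎
  ∷ 𝓤 𝟎 (pos one) 𝟎 𝟎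
  ∷ 𝓤 𝟎 𝟎 (pos one) 𝟎
  ∷ 𝓤 𝟎 𝟎 𝟎 (pos one)
  ∷ 𝓤 𝟎 (pos a) (pos bρ) (pos bρ)
  ∷ 𝓤 (pos a) 𝟎 (pos bρ) (neg bρ)
  ∷ 𝓤 (pos bρ) (neg bρ) 𝟎 (pos a)
  ∷ 𝓤 (neg bρ) (neg bρ) (pos a) 𝟎
  ∷ 𝓤 𝟎 (neg b) (pos aρ) (pos aρ)
  ∷ 𝓤 (neg b) 𝟎 (pos aρ) (neg aρ)
  ∷ 𝓤 (neg aρ) (pos aρ) 𝟎 (pos b)
  ∷ 𝓤 (pos aρ) (pos aρ) (pos b) 𝟎
  ∷ 𝓤 (neg aρ) (pos aρ) (pos b) 𝟎
  ∷ 𝓤 (pos bρ) (neg bρ) (pos a) 𝟎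
  ∷ 𝓤 (pos rho) (pos rho) 𝟎 𝟎
  ∷ 𝓤 (pos aρ) (pos aρ) 𝟎 (pos b)
  ∷ 𝓤 (neg bρ) (neg bρ) 𝟎 (pos a)
  ∷ 𝓤 (neg rho) (pos rho) 𝟎 𝟎
  ∷ 𝓤 𝟎 𝟎 (pos rho) (pos rho)
  ∷ 𝓤 (pos b) 𝟎 (pos aρ) (neg aρ)
  ∷ 𝓤 (neg a) 𝟎 (pos bρ) (neg bρ)
  ∷ 𝓥 (pos one) 𝟎
  ∷ 𝓥 𝟎 (pos one)
  ∷ 𝓥 (pos rho) (pos rho)
  ∷ 𝓥 (pos rho) (neg rho)
  ∷ []
  where
  𝓤 : Coordinate → Coordinate → Coordinate → Coordinate → Coordinates
  𝓤 t₀ t₁ t₂ t₃ = t₀ ∷ t₁ ∷ t₂ ∷ t₃ ∷ 𝟎 ∷ 𝟎 ∷ []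
  𝓥 : Coordinate → Coordinate → Coordinates
  𝓥 t₄ t₅ = 𝟎 ∷ 𝟎 ∷ 𝟎 ∷ 𝟎 ∷ t₄ ∷ t₅ ∷ []

letter : Fin 25 → Coordinates
letter = lookup letters

-- The array and its orthonormality relations

labels : Vec (Vec (Fin 25) 6) 6
labels
  = (# 21 ∷ # 0  ∷ # 22 ∷ # 1  ∷ # 2  ∷ # 3  ∷ [])
  ∷ (# 22 ∷ # 21 ∷ # 4  ∷ # 5  ∷ # 6  ∷ # 7  ∷ [])
  ∷ (# 8  ∷ # 22 ∷ # 21 ∷ # 9  ∷ # 10 ∷ # 11 ∷ [])
  ∷ (# 12 ∷ # 3  ∷ # 13 ∷ # 23 ∷ # 14 ∷ # 24 ∷ [])
  ∷ (# 15 ∷ # 2  ∷ # 16 ∷ # 24 ∷ # 23 ∷ # 17 ∷ [])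
  ∷ (# 19 ∷ # 1  ∷ # 20 ∷ # 18 ∷ # 24 ∷ # 23 ∷ [])
  ∷ []

label : Fin 6 → Fin 6 → Fin 25
label i j = lookup (lookup labels i) j

Φ₂₅≡entry : ∀ i j → Φ₂₅ i j ≡ entry (letter (label i j))
Φ₂₅≡entry i j = trans
  -- The table inside `Φ₂₅` is by computation `labels` with `entry ∘ letter` mapped over it, so no
  -- split into 36 cells is made.
  (cong (λ row → lookup row j) (lookup-map i (Vec.map (entry ∘ letter)) labels))
  (lookup-map j (entry ∘ letter) (lookup labels i))

array×10 : Fin 6 → Fin 6 → Vector ℤ[√2] 6
array×10 i j = entry×10 (letter (label i j))

Φ₂₅≈array×10 : ∀ i j → Φ₂₅ i j ≈/10 array×10 i j
Φ₂₅≈array×10 i j = subst (_≈/10 array×10 i j) (sym (Φ₂₅≡entry i j)) (entry≈ (letter (label i j)))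

rows-orthogonal : ∀ i → Orthogonal (array×10 i)
rows-orthogonal = from-yes (all? λ i → orthogonal? (array×10 i))

-- Each row of the array is itself a 6 × 6 matrix of coordinates; this relation on its columns
-- supplies the spanning half of the basis property.
rows-complete : ∀ i → Orthogonal (flip (array×10 i))
rows-complete = from-yes (all? λ i → orthogonal? (flip (array×10 i)))

columns-orthogonal : ∀ j → Orthogonal (λ i → array×10 i j)
columns-orthogonal = from-yes (all? λ j → orthogonal? (λ i → array×10 i j))

columns-complete : ∀ j → Orthogonal (flip λ i → array×10 i j)
columns-complete = from-yes (all? λ j → orthogonal? (flip λ i → array×10 i j))

Φ₂₅-isQuantumLatinSquare : IsQuantumLatinSquare Φ₂₅
Φ₂₅-isQuantumLatinSquare = record
  { units   = λ i → proj₁ (proj₁ (rows i))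
  ; rows    = rows
  ; columns = λ j → orthogonal⇒basis (λ i → Φ₂₅≈array×10 i j) (columns-orthogonal j) (columns-complete j)
  }
  where
  rows : ∀ i → IsOrthonormalBasis (Φ₂₅ i)
  rows i = orthogonal⇒basis (Φ₂₅≈array×10 i) (rows-orthogonal i) (rows-complete i)

-- Cardinality

minorNorm : Fin 25 → Fin 25 → Fin 6 → Fin 6 → ℤ
minorNorm l m k k′ = norm (u k ⊗ v k′ ⊕ ⊖ (u k′ ⊗ v k))
  where
  u = entry×10 (letter l)
  v = entry×10 (letter m)

-- As a disjunction over finite types this is decided by exhaustive search; a non-zero minor
-- excludes phase equivalence.
letters-distinct : ∀ l m → l ≡ m ⊎ ∃[ k ] ∃[ k′ ] minorNorm l m k k′ ≢ 0ℤ
letters-distinct = from-yes (all? λ l → all? λ m →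
  (l ≟ m) ⊎-dec any? λ k → any? λ k′ → ¬? (minorNorm l m k k′ ℤ.≟ 0ℤ))

label-surjective : ∀ l → ∃[ i ] ∃[ j ] label i j ≡ l
label-surjective = from-yes (all? λ l → any? λ i → any? λ j → label i j ≟ l)

label-congruent : ∀ i j i′ j′ → PhaseEquivalent (Φ₂₅ i j) (Φ₂₅ i′ j′) → label i j ≡ label i′ j′
label-congruent i j i′ j′ u∼v = fromInj₁
  (λ (k , k′ , minor≢0) → contradiction
    (phaseEquivalent⇒minors (Φ₂₅≈array×10 i j) (Φ₂₅≈array×10 i′ j′) u∼v k k′) minor≢0)
  (letters-distinct (label i j) (label i′ j′))

-- Injectivity is meant modulo phase: cells with the same label hold the same vector, so phase 1
-- relates them.
label-injective : ∀ i j i′ j′ → label i j ≡ label i′ j′ → PhaseEquivalent (Φ₂₅ i j) (Φ₂₅ i′ j′)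
label-injective i j i′ j′ l≡m = ≡⇒phaseEquivalent
  (trans (Φ₂₅≡entry i j) (trans (cong (entry ∘ letter) l≡m) (sym (Φ₂₅≡entry i′ j′))))

Φ₂₅-hasCardinality : HasCardinality Φ₂₅ 25
Φ₂₅-hasCardinality = uncurry label
  , (λ {p} {q} → label-congruent (proj₁ p) (proj₂ p) (proj₁ q) (proj₂ q))
  , (λ {p} {q} → label-injective (proj₁ p) (proj₂ p) (proj₁ q) (proj₂ q))
  -- Surjectivity between setoids asks that every cell equivalent to the chosen one also map to `l`,
  -- hence the use of congruence.
  , λ l → let i , j , label≡l = label-surjective l in
      (i , j) , λ {q} q∼p → trans (label-congruent (proj₁ q) (proj₂ q) i j q∼p) label≡l

theorem4 : IsQuantumLatinSquare Φ₂₅ × HasCardinality Φ₂₅ 25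
theorem4 = Φ₂₅-isQuantumLatinSquare , Φ₂₅-hasCardinality
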